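{- Let $G=(V,E)$ be a finite graph of girth $g$ and let $r\ge 0$ be an integer with $2r+1<g$. Then every statistic of a signing of $G$ that is a function of the switching classes of its radius-$r$ balls is constant across all $2^{|E|}$ signings of $G$. In particular, suppose that $G$ is in addition connected and that $V=A\sqcup B$ is a partition with $G[A]$ and $G[B]$ connected and every vertex of $B$ adjacent to some vertex of $A$, and set $E_L=E(A)\cup E(A,B)$, $E_R=E(B)$. Then every such radius-$r$ statistic is constant across all signings of $G$, while the conditional ground-state matrix $W$ of $G$ across $(E_L,E_R)$ has min-plus factorization rank $2^{|B|-1}=2^{s}$, the maximum possible permitted by the state complexity $s$ of the cut space of $G$ at $(E_L,E_R)$.
   Context: The girth is the length of a shortest cycle ($+\infty$ if there are none). Connected graphs are nonempty. $E(A)$, $E(B)$ are the sets of edges inside $A$, inside $B$; $E(A,B)$ is the set of edges between $A$ and $B$. A signing is a map $\sigma:E\to\{\pm1\}$. For a vertex set $S$, switching $S$ flips the signs of exactly the edges with exactly one endpoint in $S$; two signings of a graph are switching-equivalent if they differ by switching some vertex set, and a switching class is an equivalence class. For $v\in V$, $B_r(v)$ is the set of vertices at distance at most $r$ from $v$. The switching classes of the radius-$r$ balls of $\sigma$ are the family, indexed by $v\in V$, of the switching classes of the restrictions of $\sigma$ to the induced subgraphs $G[B_r(v)]$ (as signings of these subgraphs). A statistic that is a function of these classes is any function $f$ of signings of $G$ such that $f(\sigma)$ depends only on this family. For $S\subseteq V$, $\delta(S)\in\mathbb{F}_2^E$ is the indicator vector of the set of edges with exactly one endpoint in $S$. The cut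 space is $B_G=\{\delta(S):S\subseteq V\}\subseteq\mathbb{F}_2^E$. Its state complexity at $(E_L,E_R)$ is $s=\dim B_G-\dim C_L-\dim C_R$, where $C_L=\{c\in B_G:c|_{E_R}=0\}$ and $C_R=\{c\in B_G:c|_{E_L}=0\}$. The min-plus factorization rank of the conditional ground-state matrix never exceeds $2^s$; this is the sense of "maximum possible permitted by the state complexity". The conditional ground-state matrix $W$ has rows indexed by $\mathbb{F}_2^{E_L}$, columns by $\mathbb{F}_2^{E_R}$, and entries $W(\omega_L,\omega_R)=\min_{S\subseteq V}|(\omega_L,\omega_R)\oplus\delta(S)|$, where $|\cdot|$ is Hamming weight. Min-plus factorization rank: the least $k$ such that there are functions $u_1,\dots,u_k$ on the row index set and $v_1,\dots,v_k$ on the column index set, with values in $\mathbb{R}\cup\{+\infty\}$, with $W(x,y)=\min_{1\le t\le k}(u_t(x)+v_t(y))$ for all $x,y$. -}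

module Defs where

open import Algebra.Bundles using (CommutativeRing)
open import Data.Bool.Base using (Bool; true; false; if_then_else_; _∧_; _∨_; _xor_)
open import Data.Bool.Properties using (xor-∧-commutativeRing)
open import Data.Fin.Base as Fin using (Fin)
open import Data.Fin.Subset
  using (Subset; inside; outside; _∈_; _⊆_; _∩_; _∪_; ⊤; ⊥; ∣_∣; Nonempty)
open import Data.Fin.Subset.Properties using (_∈?_)
open import Data.Integer.Base as ℤ using (+_)
open import Data.List.Base using (List; []; _∷_)
open import Data.List.Relation.Unary.Unique.Propositional using (Unique)
open import Data.Nat.Base as ℕ using (ℕ; zero; suc)
import Data.Nat.Properties as ℕ
open import Data.Product.Base using (Σ; ∃; _×_; _,_; proj₁; proj₂)
open import Data.Rational.Base as ℚ using (ℚ; 0ℚ; ½)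
import Data.Rational.Properties as ℚ
import Data.Rational.Solver as ℚ
open import Data.Sign.Base using (Sign; opposite)
open import Data.Sum.Base using (_⊎_; inj₁; inj₂)
import Data.Vec.Base as Vec
open import Data.Vec.Functional using (Vector; foldr)
open import Function.Definitions using (Injective)
open import Level using (Level)
open import Relation.Binary.Construct.Closure.ReflexiveTransitive using (Star)
open import Relation.Binary.PropositionalEquality
  using (_≡_; _≗_; refl; sym; trans; cong; subst; subst₂)
open import Relation.Nullary.Construct.Add.Supremum using (_⁺; [_]; ⊤⁺)
open import Relation.Nullary.Decidable.Core using (yes; no)
open import Relation.Nullary.Negation.Core using (¬_)
open import Relation.Unary using (Pred)

import Algebra.Properties.Monoid.Sum
  (CommutativeRing.+-monoid xor-∧-commutativeRing) as 𝔽₂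
import Relation.Binary.Construct.Add.Supremum.Equality as Equality⁺
import Relation.Binary.Construct.Add.Supremum.Strict as Strict⁺

-- Cauchy sequences of rationals; equality of reals is _≈_ below.
record ℝ : Set where
  constructor mkℝ
  field
    seq    : ℕ → ℚ
    cauchy : ∀ ε → 0ℚ ℚ.< ε → ∃ λ N → ∀ i j → N ℕ.≤ i → N ℕ.≤ j →
             ℚ.∣ seq i ℚ.- seq j ∣ ℚ.< ε

open ℝ public

infix 4 _≈_

_≈_ : ℝ → ℝ → Set
x ≈ y = ∀ ε → 0ℚ ℚ.< ε → ∃ λ N → ∀ i → N ℕ.≤ i →
        ℚ.∣ seq x i ℚ.- seq y i ∣ ℚ.< ε

private
  p≤∣p∣ : ∀ p → p ℚ.≤ ℚ.∣ p ∣
  p≤∣p∣ p with ℚ.≤-total 0ℚ p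
  ... | inj₁ 0≤p = ℚ.≤-reflexive (sym (ℚ.0≤p⇒∣p∣≡p 0≤p))
  ... | inj₂ p≤0 = ℚ.≤-trans p≤0 (ℚ.0≤∣p∣ p)

  ∣∣<-intro : ∀ {p ε} → p ℚ.< ε → ℚ.- p ℚ.< ε → ℚ.∣ p ∣ ℚ.< ε
  ∣∣<-intro {p} {ε} p<ε -p<ε with ℚ.∣p∣≡p∨∣p∣≡-p p
  ... | inj₁ eq = subst (ℚ._< ε) (sym eq) p<ε
  ... | inj₂ eq = subst (ℚ._< ε) (sym eq) -p<ε

  neg-sub : ∀ p q → ℚ.- (p ℚ.- q) ≡ q ℚ.- p
  neg-sub = solve 2 (λ p q → :- (p :- q) := q :- p) refl
    where open ℚ.+-*-Solver

  ⊓-sub-< : ∀ a b c d {ε} → a ℚ.- c ℚ.< ε → b ℚ.- d ℚ.< ε →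
            (a ℚ.⊓ b) ℚ.- (c ℚ.⊓ d) ℚ.< ε
  ⊓-sub-< a b c d {ε} a-c<ε b-d<ε with ℚ.⊓-sel c d
  ... | inj₁ eq = subst (λ z → (a ℚ.⊓ b) ℚ.- z ℚ.< ε) (sym eq)
                    (ℚ.≤-<-trans (ℚ.+-monoˡ-≤ (ℚ.- c) (ℚ.p⊓q≤p a b)) a-c<ε)
  ... | inj₂ eq = subst (λ z → (a ℚ.⊓ b) ℚ.- z ℚ.< ε) (sym eq)
                    (ℚ.≤-<-trans (ℚ.+-monoˡ-≤ (ℚ.- d) (ℚ.p⊓q≤q a b)) b-d<ε)

  ⊓-close : ∀ a b c d {ε} → ℚ.∣ a ℚ.- c ∣ ℚ.< ε → ℚ.∣ b ℚ.- d ∣ ℚ.< ε →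
            ℚ.∣ (a ℚ.⊓ b) ℚ.- (c ℚ.⊓ d) ∣ ℚ.< ε
  ⊓-close a b c d {ε} p q = ∣∣<-intro
    (⊓-sub-< a b c d (below a c p) (below b d q))
    (subst (ℚ._< ε) (sym (neg-sub (a ℚ.⊓ b) (c ℚ.⊓ d)))
      (⊓-sub-< c d a b (above a c p) (above b d q)))
    where
    below : ∀ x y → ℚ.∣ x ℚ.- y ∣ ℚ.< ε → x ℚ.- y ℚ.< ε
    below x y = ℚ.≤-<-trans (p≤∣p∣ (x ℚ.- y))

    above : ∀ x y → ℚ.∣ x ℚ.- y ∣ ℚ.< ε → y ℚ.- x ℚ.< ε
    above x y h = ℚ.≤-<-trans (p≤∣p∣ (y ℚ.- x))
      (subst (ℚ._< ε) (trans (sym (ℚ.∣-p∣≡∣p∣ (x ℚ.- y))) (cong ℚ.∣_∣ (neg-sub x y))) h)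

  +-close : ∀ a b c d {ε} → ℚ.∣ a ℚ.- c ∣ ℚ.< ½ ℚ.* ε → ℚ.∣ b ℚ.- d ∣ ℚ.< ½ ℚ.* ε →
            ℚ.∣ (a ℚ.+ b) ℚ.- (c ℚ.+ d) ∣ ℚ.< ε
  +-close a b c d {ε} p q =
    subst₂ (λ x y → ℚ.∣ x ∣ ℚ.< y) regroup halves
      (ℚ.≤-<-trans (ℚ.∣p+q∣≤∣p∣+∣q∣ (a ℚ.- c) (b ℚ.- d)) (ℚ.+-mono-< p q))
    where
    regroup : (a ℚ.- c) ℚ.+ (b ℚ.- d) ≡ (a ℚ.+ b) ℚ.- (c ℚ.+ d)
    regroup = solve 4 (λ a b c d → (a :- c) :+ (b :- d) := (a :+ b) :- (c :+ d)) refl a b c d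
      where open ℚ.+-*-Solver

    halves : ½ ℚ.* ε ℚ.+ ½ ℚ.* ε ≡ ε
    halves = trans (sym (ℚ.*-distribʳ-+ ε ½ ½)) (ℚ.*-identityˡ ε)

  ½*-pos : ∀ {ε} → 0ℚ ℚ.< ε → 0ℚ ℚ.< ½ ℚ.* ε
  ½*-pos 0<ε = ℚ.*-monoʳ-<-pos ½ 0<ε

infixl 6 _+ʳ_
infixl 7 _⊓ʳ_

_+ʳ_ : ℝ → ℝ → ℝ
seq    (x +ʳ y) i = seq x i ℚ.+ seq y i
cauchy (x +ʳ y) ε 0<ε with cauchy x (½ ℚ.* ε) (½*-pos 0<ε) | cauchy y (½ ℚ.* ε) (½*-pos 0<ε)
... | M , f | N , g = M ℕ.⊔ N , λ i j M⊔N≤i M⊔N≤j → +-close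
  (seq x i) (seq y i) (seq x j) (seq y j)
  (f i j (ℕ.m⊔n≤o⇒m≤o M N M⊔N≤i) (ℕ.m⊔n≤o⇒m≤o M N M⊔N≤j))
  (g i j (ℕ.m⊔n≤o⇒n≤o M N M⊔N≤i) (ℕ.m⊔n≤o⇒n≤o M N M⊔N≤j))

_⊓ʳ_ : ℝ → ℝ → ℝ
seq    (x ⊓ʳ y) i = seq x i ℚ.⊓ seq y i
cauchy (x ⊓ʳ y) ε 0<ε with cauchy x ε 0<ε | cauchy y ε 0<ε
... | M , f | N , g = M ℕ.⊔ N , λ i j M⊔N≤i M⊔N≤j → ⊓-close
  (seq x i) (seq y i) (seq x j) (seq y j)
  (f i j (ℕ.m⊔n≤o⇒m≤o M N M⊔N≤i) (ℕ.m⊔n≤o⇒m≤o M N M⊔N≤j))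
  (g i j (ℕ.m⊔n≤o⇒n≤o M N M⊔N≤i) (ℕ.m⊔n≤o⇒n≤o M N M⊔N≤j))

fromℚ : ℚ → ℝ
seq    (fromℚ q) _ = q
cauchy (fromℚ q) ε 0<ε = 0 , λ _ _ _ _ → subst (ℚ._< ε) (sym ∣q-q∣≡0) 0<ε
  where
  ∣q-q∣≡0 : ℚ.∣ q ℚ.- q ∣ ≡ 0ℚ
  ∣q-q∣≡0 = cong ℚ.∣_∣ (ℚ.+-inverseʳ q)

fromℕ : ℕ → ℝ
fromℕ k = fromℚ (+ k ℚ./ 1)

open Equality⁺ _≈_ public using (_≈⁺_)

infixl 6 _+⁺_
infixl 7 _⊓⁺_

_+⁺_ : ℝ ⁺ → ℝ ⁺ → ℝ ⁺
[ x ] +⁺ [ y ] = [ x +ʳ y ]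
[ x ] +⁺ ⊤⁺    = ⊤⁺
⊤⁺    +⁺ y     = ⊤⁺

_⊓⁺_ : ℝ ⁺ → ℝ ⁺ → ℝ ⁺
[ x ] ⊓⁺ [ y ] = [ x ⊓ʳ y ]
[ x ] ⊓⁺ ⊤⁺    = [ x ]
⊤⁺    ⊓⁺ y     = y

minimum : ∀ {k} → Vector (ℝ ⁺) k → ℝ ⁺
minimum = foldr _⊓⁺_ ⊤⁺

module _ {X Y : Set} (W : X → Y → ℕ) where

  MinPlusFactorization : ℕ → Set
  MinPlusFactorization k =
    Σ (Fin k → X → ℝ ⁺) λ u → Σ (Fin k → Y → ℝ ⁺) λ v →
    ∀ x y → [ fromℕ (W x y) ] ≈⁺ minimum (λ t → u t x +⁺ v t y)

  IsMinPlusRank : ℕ → Set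
  IsMinPlusRank k = MinPlusFactorization k ×
                    (∀ l → MinPlusFactorization l → k ℕ.≤ l)

-- 𝔽₂ is represented by Bool, with _xor_ as addition and _∧_ as multiplication.
module _ {m : ℕ} where

  combination : ∀ {d} → Vector Bool d → (Fin d → Vector Bool m) → Vector Bool m
  combination a b e = 𝔽₂.sum (λ i → a i ∧ b i e)

  LinearlyIndependent : ∀ {d} → (Fin d → Vector Bool m) → Set
  LinearlyIndependent b =
    ∀ a → (∀ e → combination a b e ≡ false) → ∀ i → a i ≡ false

  Spans : ∀ {d} → (Fin d → Vector Bool m) → Pred (Vector Bool m) _ → Set
  Spans b U = ∀ c → U c → ∃ λ a → c ≗ combination a b

  HasDimension : Pred (Vector Bool m) _ → ℕ → Set
  HasDimension U d = Σ (Fin d → Vector Bool m) λ b →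
    (∀ i → U (b i)) × LinearlyIndependent b × Spans b U

weight : ∀ {m} → Vector Bool m → ℕ
weight c = ∣ Vec.tabulate c ∣

minOverSubsets : ∀ {n} → (Subset n → ℕ) → ℕ
minOverSubsets {zero}  f = f Vec.[]
minOverSubsets {suc n} f =
  minOverSubsets (λ S → f (outside Vec.∷ S)) ℕ.⊓ minOverSubsets (λ S → f (inside Vec.∷ S))

-- An edge {u , v} with u < v has ends (u , v): `ordered` excludes loops
-- and `simple` excludes parallel edges.
record Graph (n m : ℕ) : Set where
  field
    ends    : Fin m → Fin n × Fin n
    ordered : ∀ e → proj₁ (ends e) Fin.< proj₂ (ends e)
    simple  : Injective _≡_ _≡_ ends

  src tgt : Fin m → Fin n
  src e = proj₁ (ends e)
  tgt e = proj₂ (ends e)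

record Partition {n : ℕ} (A B : Subset n) : Set where
  field
    cover    : A ∪ B ≡ ⊤
    disjoint : A ∩ B ≡ ⊥

module _ {n m : ℕ} (G : Graph n m) where

  open Graph G

  Adjacent : Fin n → Fin n → Set
  Adjacent u v = ∃ λ e → ends e ≡ (u , v) ⊎ ends e ≡ (v , u)

  data Walk : Fin n → Fin n → ℕ → Set where
    []  : ∀ {u} → Walk u u 0
    _∷_ : ∀ {u v w k} → Adjacent u v → Walk v w k → Walk u w (suc k)

  vertices : ∀ {u v k} → Walk u v k → List (Fin n)
  vertices {u} []      = u ∷ []
  vertices {u} (_ ∷ p) = u ∷ vertices p

  -- A cycle of length k + 1 is a path of length k ≥ 2 together with an
  -- edge joining its ends.
  data Cycle : ℕ → Set where
    close : ∀ {u v k} (p : Walk u v k) → Unique (vertices p) →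
            2 ℕ.≤ k → Adjacent v u → Cycle (suc k)

  IsGirth : ℕ ⁺ → Set
  IsGirth [ g ] = Cycle g × (∀ k → Cycle k → g ℕ.≤ k)
  IsGirth ⊤⁺    = ∀ k → ¬ Cycle k

  -- The induced subgraph on A is connected, hence nonempty.
  ConnectedOn : Subset n → Set
  ConnectedOn A = Nonempty A ×
    (∀ u v → u ∈ A → v ∈ A → Star (λ x y → x ∈ A × y ∈ A × Adjacent x y) u v)

  Connected : Set
  Connected = ConnectedOn ⊤

  δ : Subset n → Vector Bool m
  δ S e = Vec.lookup S (src e) xor Vec.lookup S (tgt e)

  CutSpace : Pred (Vector Bool m) _
  CutSpace c = ∃ λ S → c ≗ δ S

  -- For (L , R) = (E_L , E_R), C_L is CutSpaceVanishingOn R and C_R is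
  -- CutSpaceVanishingOn L.
  CutSpaceVanishingOn : Subset m → Pred (Vector Bool m) _
  CutSpaceVanishingOn F c = CutSpace c × (∀ e → e ∈ F → c e ≡ false)

  IsStateComplexity : (L R : Subset m) → ℕ → Set
  IsStateComplexity L R s = ∃ λ dB → ∃ λ dL → ∃ λ dR →
    HasDimension CutSpace dB ×
    HasDimension (CutSpaceVanishingOn R) dL ×
    HasDimension (CutSpaceVanishingOn L) dR ×
    + s ≡ (+ dB ℤ.- + dL) ℤ.- + dR

  edgesInside : Subset n → Subset m
  edgesInside A = Vec.tabulate λ e → Vec.lookup A (src e) ∧ Vec.lookup A (tgt e)

  edgesBetween : Subset n → Subset n → Subset m
  edgesBetween A B = Vec.tabulate λ e →
    (Vec.lookup A (src e) ∧ Vec.lookup B (tgt e)) ∨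
    (Vec.lookup B (src e) ∧ Vec.lookup A (tgt e))

  𝔽₂^ : Subset m → Set
  𝔽₂^ F = ∀ e → e ∈ F → Bool

  -- The vector (ωL , ωR), for disjoint L and R covering all edges; the last
  -- clause is then unreachable.
  glue : ∀ {L R} → 𝔽₂^ L → 𝔽₂^ R → Vector Bool m
  glue {L} {R} ωL ωR e with e ∈? L | e ∈? R
  ... | yes e∈L | _       = ωL e e∈L
  ... | no _    | yes e∈R = ωR e e∈R
  ... | no _    | no _    = false

  groundStateMatrix : (L R : Subset m) → 𝔽₂^ L → 𝔽₂^ R → ℕ
  groundStateMatrix L R ωL ωR =
    minOverSubsets λ S → weight (λ e → glue ωL ωR e xor δ S e)

  Signing : Set
  Signing = Fin m → Sign

  switch : Subset n → Signing → Signing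
  switch S σ e = if δ S e then opposite (σ e) else σ e

  -- The restrictions of σ and τ to the subgraph induced on U are
  -- switching-equivalent there.
  SwitchingEquivalentOn : Pred (Fin n) _ → Signing → Signing → Set
  SwitchingEquivalentOn U σ τ = ∃ λ S → (∀ v → v ∈ S → U v) ×
    (∀ e → U (src e) → U (tgt e) → τ e ≡ switch S σ e)

  Ball : ℕ → Fin n → Pred (Fin n) _
  Ball r v u = ∃ λ k → k ℕ.≤ r × Walk v u k

  SameBallClasses : ℕ → Signing → Signing → Set
  SameBallClasses r σ τ = ∀ v → SwitchingEquivalentOn (Ball r v) σ τ

  IsRadiusStatistic : ∀ {a} {X : Set a} → ℕ → (Signing → X) → Set a
  IsRadiusStatistic r f = ∀ σ τ → SameBallClasses r σ τ → f σ ≡ f τ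

  RadiusStatisticsConstant : (a : Level) → ℕ → Set (Level.suc a)
  RadiusStatisticsConstant a r = (X : Set a) (f : Signing → X) →
    IsRadiusStatistic r f → ∀ σ τ → f σ ≡ f τ

open Strict⁺ ℕ._<_ public using (_<⁺_)

{-# OPTIONS --safe #-}

-- A closed walk shorter than the girth decomposes into backtracked edges, so every
-- vector in 𝔽₂^E sums to zero along it. Hence the disagreement of two signings on
-- a ball of radius r with 2r + 1 < g is the coboundary of a potential, namely its
-- sum along any path from the centre, and the signings are switching-equivalent.
--
-- Fix b₀ ∈ B. Up to complement, a cut is δ S with b₀ ∉ S. Splitting the minimum
-- defining W according to the trace S ∩ B ⊆ B ∖ {b₀} gives 2^(|B|-1) min-plus
-- terms. Conversely a cut is determined by its restriction to E_L, and among the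
-- traces also by its restriction to E_R, so W vanishes at (δ T|E_L , δ T′|E_R)
-- exactly when T = T′. Two of these zeros cannot be attained by the same term:
-- exchanging the columns would make two positive entries sum to zero.
--
-- For b₀ ∉ P the star cuts δ {x}, x ∈ P, are a basis of {δ S : S ⊆ P}. The sets
-- P = V ∖ {b₀}, A, ∅ give the cut space, C_L and C_R.
module Submission where

open import Defs
open import Algebra.Bundles using (CommutativeMonoid; CommutativeRing)
open import Data.Bool.Base using (Bool; true; false; not; _∧_; _∨_; _xor_; if_then_else_)
open import Data.Bool.Properties
  using (if-eta; ¬-not; xor-assoc; xor-comm; xor-identityʳ; xor-same; xor-annihilates-not;
         ∧-distribˡ-xor; ∧-identityʳ; ∧-zeroʳ; xor-∧-commutativeRing)
open import Data.Fin.Base as Fin using (Fin; zero; suc)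
import Data.Fin.Properties as Fin
open import Data.Fin.Subset
  using (Subset; inside; outside; _∈_; _∉_; _⊆_; _∪_; _-_; ∣_∣; ⁅_⁆; ∁; ⊤; ⊥)
open import Data.Fin.Subset.Properties
import Data.Integer.Base as ℤ
import Data.Integer.Properties as ℤ
import Data.Integer.Solver as ℤ
import Data.List.Membership.DecPropositional as DecMembership
open import Data.List.Membership.Propositional using () renaming (_∈_ to _∈ˡ_)
open import Data.List.Relation.Unary.All using ([])
open import Data.List.Relation.Unary.All.Properties using (¬Any⇒All¬)
open import Data.List.Relation.Unary.AllPairs using ([]; _∷_)
open import Data.List.Relation.Unary.Any using (here; there)
open import Data.List.Relation.Unary.Unique.Propositional using (Unique)
open import Data.Nat.Base using (ℕ; zero; suc; _+_; _*_; _^_; _∸_; _≤_; _<_; _⊔_; z≤n; s≤s)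
import Data.Nat.Properties as ℕ
open import Data.Product.Base using (Σ; ∃; ∃₂; _×_; _,_; proj₁; proj₂)
import Data.Product.Properties as Product
open import Data.Rational.Base as ℚ using (ℚ; 0ℚ; ½)
import Data.Rational.Properties as ℚ
import Data.Rational.Solver as ℚ
open import Data.Rational.Unnormalised.Base as ℚᵘ using (mkℚᵘ)
import Data.Rational.Unnormalised.Properties as ℚᵘ
open import Data.Sign.Base using (opposite) renaming (+ to ⊕; - to ⊖)
import Data.Sign.Properties as Sign
open import Data.Sum.Base using (_⊎_; inj₁; inj₂)
open import Data.Vec.Base as Vec using ([]; _∷_; lookup; tabulate)
open import Data.Vec.Functional using (Vector)
open import Data.Vec.Properties
  using ([]=⇒lookup; lookup⇒[]=; lookup-map; lookup-replicate; lookup-zipWith;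
         lookup∘tabulate; tabulate-cong)
open import Function.Base using (_∘_)
open import Function.Bundles using (Inverse)
open import Level using (Level)
open import Relation.Binary.Construct.Closure.ReflexiveTransitive using (Star; ε; _◅_)
open import Relation.Binary.PropositionalEquality
open import Relation.Nullary.Construct.Add.Supremum using (_⁺; [_]; ⊤⁺)
open import Relation.Nullary.Decidable
  using (Dec; yes; no; does; decidable-stable; map′; _×-dec_; _⊎-dec_)
open import Relation.Nullary.Negation using (¬_; contradiction)

open import Algebra.Properties.CommutativeMonoid.Sum
  (CommutativeRing.+-commutativeMonoid xor-∧-commutativeRing)
  using (sum; sum-cong-≗; ∑-distrib-+; sum-replicate-zero)
open import Algebra.Properties.CommutativeSemigroup
  (CommutativeMonoid.commutativeSemigroup
    (CommutativeRing.+-commutativeMonoid xor-∧-commutativeRing))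
  using (x∙yz≈y∙xz)
import Relation.Binary.Construct.Add.Supremum.Equality as Equality⁺
import Relation.Binary.Construct.Add.Supremum.Strict as Strict⁺

-- Closed walks shorter than the girth

xor≡false⇒≡ : ∀ x y → x xor y ≡ false → x ≡ y
xor≡false⇒≡ false false _ = refl
xor≡false⇒≡ true  true  _ = refl

module _ {n m : ℕ} (G : Graph n m) where

  open Graph G

  private variable
    u v w : Fin n
    k l   : ℕ

  Adjacent-sym : Adjacent G u v → Adjacent G v u
  Adjacent-sym (e , inj₁ eq) = e , inj₂ eq
  Adjacent-sym (e , inj₂ eq) = e , inj₁ eq

  proj₁-Adjacent-sym : (a : Adjacent G u v) → proj₁ (Adjacent-sym a) ≡ proj₁ a
  proj₁-Adjacent-sym (e , inj₁ _) = refl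
  proj₁-Adjacent-sym (e , inj₂ _) = refl

  ends-< : ∀ e → ends e ≡ (u , v) → u Fin.< v
  ends-< e refl = ordered e

  ¬Adjacent-refl : ¬ Adjacent G u u
  ¬Adjacent-refl (e , inj₁ eq) = Fin.<-irrefl refl (ends-< e eq)
  ¬Adjacent-refl (e , inj₂ eq) = Fin.<-irrefl refl (ends-< e eq)

  -- Equal orientations are settled by `simple`; opposite orientations would order `u` and `v` both
  -- ways. This turns a closed walk of length two into a backtracked edge.
  edge-unique : (a b : Adjacent G u v) → proj₁ a ≡ proj₁ b
  edge-unique (e , inj₁ p) (f , inj₁ q) = simple (trans p (sym q))
  edge-unique (e , inj₂ p) (f , inj₂ q) = simple (trans p (sym q))
  edge-unique (e , inj₁ p) (f , inj₂ q) = contradiction (ends-< f q) (Fin.<-asym (ends-< e p))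
  edge-unique (e , inj₂ p) (f , inj₁ q) = contradiction (ends-< f q) (Fin.<-asym (ends-< e p))

  infixr 5 _++_
  infixl 5 _∷ʳ_

  _++_ : Walk G u v k → Walk G v w l → Walk G u w (k + l)
  []      ++ q = q
  (a ∷ p) ++ q = a ∷ (p ++ q)

  _∷ʳ_ : Walk G u v k → Adjacent G v w → Walk G u w (suc k)
  []      ∷ʳ b = b ∷ []
  (a ∷ p) ∷ʳ b = a ∷ (p ∷ʳ b)

  reverse : Walk G u v k → Walk G v u k
  reverse []      = []
  reverse (a ∷ p) = reverse p ∷ʳ Adjacent-sym a

  Adjacent? : ∀ u v → Dec (Adjacent G u v)
  Adjacent? u v = Fin.any? λ e → ends e ≟ (u , v) ⊎-dec ends e ≟ (v , u)
    where _≟_ = Product.≡-dec Fin._≟_ Fin._≟_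

  Walk? : ∀ u v k → Dec (Walk G u v k)
  Walk? u v zero    = map′ (λ { refl → [] }) (λ { [] → refl }) (u Fin.≟ v)
  Walk? u v (suc k) = map′ (λ (_ , a , p) → a ∷ p) (λ { (a ∷ p) → _ , a , p })
    (Fin.any? λ w → Adjacent? u w ×-dec Walk? w v k)

  Ball? : ∀ r v u → Dec (Ball G r v u)
  Ball? r v u = map′ (λ { (k , s≤s k≤r , p) → k , k≤r , p }) (λ (k , k≤r , p) → k , s≤s k≤r , p)
    (ℕ.anyUpTo? (Walk? v u) (suc r))

  module _ (d : Fin m → Bool) where

    sumAlong : Walk G u v k → Bool
    sumAlong []            = false
    sumAlong ((e , _) ∷ p) = d e xor sumAlong p

    sumAlong-++ : (p : Walk G u v k) (q : Walk G v w l) →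
                  sumAlong (p ++ q) ≡ sumAlong p xor sumAlong q
    sumAlong-++ []            q = refl
    sumAlong-++ ((e , _) ∷ p) q =
      trans (cong (d e xor_) (sumAlong-++ p q)) (sym (xor-assoc (d e) _ _))

    sumAlong-∷ʳ : (p : Walk G u v k) (a : Adjacent G v w) →
                  sumAlong (p ∷ʳ a) ≡ sumAlong p xor d (proj₁ a)
    sumAlong-∷ʳ []            a = xor-identityʳ _
    sumAlong-∷ʳ ((e , _) ∷ p) a =
      trans (cong (d e xor_) (sumAlong-∷ʳ p a)) (sym (xor-assoc (d e) _ _))

    sumAlong-reverse : (p : Walk G u v k) → sumAlong (reverse p) ≡ sumAlong p
    sumAlong-reverse []      = refl
    sumAlong-reverse (a ∷ p) = trans (sumAlong-∷ʳ (reverse p) (Adjacent-sym a))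
      (trans (cong₂ _xor_ (sumAlong-reverse p) (cong d (proj₁-Adjacent-sym a)))
             (xor-comm (sumAlong p) (d (proj₁ a))))

    splitAt : (p : Walk G u w k) → v ∈ˡ vertices G p →
              ∃₂ λ i j → Σ (Walk G u v i) λ q → Σ (Walk G v w j) λ q′ →
              i + j ≡ k × sumAlong p ≡ sumAlong q xor sumAlong q′
    splitAt []      (here refl)  = _ , _ , [] , [] , refl , refl
    splitAt (a ∷ p) (here refl)  = _ , _ , [] , a ∷ p , refl , refl
    splitAt (a ∷ p) (there v∈p) with splitAt p v∈p
    ... | i , j , q , q′ , i+j≡k , eq = suc i , j , a ∷ q , q′ , cong suc i+j≡k ,
      trans (cong (d (proj₁ a) xor_) eq) (sym (xor-assoc (d (proj₁ a)) _ _))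

    -- A repeated vertex lets a closed subwalk `c` be cut out, and `xor` does not care where in the
    -- walk its edges stood. The length `suc i` records that `c` is nonempty, so what remains is
    -- strictly shorter.
    path-or-detour : (p : Walk G u w k) → Unique (vertices G p) ⊎
      ∃₂ λ i j → ∃ λ v → Σ (Walk G v v (suc i)) λ c → Σ (Walk G u w j) λ q →
      suc i + j ≡ k × sumAlong p ≡ sumAlong c xor sumAlong q
    path-or-detour []      = inj₁ ([] ∷ [])
    path-or-detour {u = u} (a ∷ p) with path-or-detour p
    ... | inj₂ (i , j , v , c , q , i+j≡k , eq) =
      inj₂ (i , suc j , v , c , a ∷ q , trans (ℕ.+-suc (suc i) j) (cong suc i+j≡k) ,
            trans (cong (d (proj₁ a) xor_) eq) (x∙yz≈y∙xz (d (proj₁ a)) (sumAlong c) _))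
    ... | inj₁ unique with DecMembership._∈?_ Fin._≟_ u (vertices G p)
    ...   | no u∉p  = inj₁ (¬Any⇒All¬ _ u∉p ∷ unique)
    ...   | yes u∈p with splitAt p u∈p
    ...     | i , j , q , q′ , i+j≡k , eq =
      inj₂ (i , j , u , a ∷ q , q′ , cong suc i+j≡k ,
            trans (cong (d (proj₁ a) xor_) eq) (sym (xor-assoc (d (proj₁ a)) _ _)))

    -- Induction on the bound `b`. The first edge is set aside and the rest is examined: a detour
    -- splits the walk into two shorter closed walks, while a path leaves only a loop, a backtracked
    -- edge, or a genuine cycle. Loops do not exist, and a cycle would violate `long`.
    closedWalk-sum : ∀ b → (∀ k → Cycle G k → b < k) →
                     (p : Walk G u u k) → k ≤ b → sumAlong p ≡ false
    closedWalk-sum b _ [] _ = refl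
    closedWalk-sum (suc b) long (a ∷ p) (s≤s k≤b) with path-or-detour p
    ... | inj₂ (i , j , v , c , q , refl , eq) = begin
      d (proj₁ a) xor sumAlong p                    ≡⟨ cong (d (proj₁ a) xor_) eq ⟩
      d (proj₁ a) xor (sumAlong c xor sumAlong q)   ≡⟨ x∙yz≈y∙xz (d (proj₁ a)) (sumAlong c) _ ⟩
      sumAlong c xor sumAlong (a ∷ q)               ≡⟨ cong₂ _xor_
        -- With `p` of length `suc i + j ≤ b`, both `c` (length `suc i`) and `a ∷ q` (length
        -- `suc j`) fall under the smaller bound.
        (closedWalk-sum b long′ c (ℕ.≤-trans (ℕ.m≤m+n (suc i) j) k≤b))
        (closedWalk-sum b long′ (a ∷ q) (ℕ.≤-trans (s≤s (ℕ.m≤n+m j i)) k≤b)) ⟩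
      false                                         ∎
      where
      open ≡-Reasoning
      long′ : ∀ k → Cycle G k → b < k
      long′ k c = ℕ.<-trans (ℕ.n<1+n b) (long k c)
    closedWalk-sum (suc b) long (a ∷ []) _ | inj₁ _ = contradiction a ¬Adjacent-refl
    closedWalk-sum (suc b) long (a ∷ a′ ∷ []) _ | inj₁ _ = begin
      d (proj₁ a) xor (d (proj₁ a′) xor false)  ≡⟨ cong (d (proj₁ a) xor_) (xor-identityʳ _) ⟩
      d (proj₁ a) xor d (proj₁ a′)              ≡⟨ cong (λ e → d e xor d (proj₁ a′)) (trans
        (edge-unique a (Adjacent-sym a′)) (proj₁-Adjacent-sym a′)) ⟩
      d (proj₁ a′) xor d (proj₁ a′)             ≡⟨ xor-same (d (proj₁ a′)) ⟩
      false                                     ∎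
      where open ≡-Reasoning
    -- Here `p` is a path of length at least two whose ends are joined by `a`, hence a cycle of
    -- length at most `suc b`.
    closedWalk-sum (suc b) long (a ∷ p@(_ ∷ _ ∷ _)) (s≤s k≤b) | inj₁ unique =
      contradiction (s≤s k≤b) (ℕ.<⇒≱ (long _ (close p unique (s≤s (s≤s z≤n)) a)))

  module _ {r : ℕ} (long : ∀ k → Cycle G k → 2 * r + 1 < k) (σ τ : Signing G) (v : Fin n) where

    private
      disagreement : Fin m → Bool
      disagreement e = not (does (σ e Sign.≟ τ e))

      potential : ∀ {u} → Dec (Ball G r v u) → Bool
      potential (yes (_ , _ , p)) = sumAlong disagreement p
      -- This default keeps `potentialSet` inside the ball, as switching on the induced subgraph
      -- requires.
      potential (no _)            = false

      potentialSet : Subset n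
      potentialSet = tabulate λ u → potential (Ball? r v u)

      -- The chosen walk to one end, the edge, and the reversed walk from the other end form a
      -- closed walk of length at most `r + 1 + r`, so the disagreement sums to zero along it.
      -- Quantifying over the two decisions exposes the walks on which `potential` depends.
      potential-edge : ∀ e (x : Dec (Ball G r v (src e))) (y : Dec (Ball G r v (tgt e))) →
                       Ball G r v (src e) → Ball G r v (tgt e) →
                       potential x xor potential y ≡ disagreement e
      potential-edge e (no ¬x) _ x _ = contradiction x ¬x
      potential-edge e _ (no ¬y) _ y = contradiction y ¬y
      potential-edge e (yes (k , k≤r , p)) (yes (l , l≤r , q)) _ _ =
        xor≡false⇒≡ _ _ (begin
          (sumAlong d p xor sumAlong d q) xor d e            ≡⟨ xor-assoc (sumAlong d p) _ _ ⟩
          sumAlong d p xor (sumAlong d q xor d e)            ≡⟨ cong (sumAlong d p xor_) (xor-comm _ (d e)) ⟩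
          sumAlong d p xor (d e xor sumAlong d q)            ≡⟨ cong (λ z → sumAlong d p xor (d e xor z)) (sumAlong-reverse d q) ⟨
          sumAlong d p xor sumAlong d (edge ∷ reverse q)     ≡⟨ sumAlong-++ d p (edge ∷ reverse q) ⟨
          sumAlong d (p ++ edge ∷ reverse q)                 ≡⟨ closedWalk-sum d (2 * r + 1) long (p ++ edge ∷ reverse q) short ⟩
          false                                              ∎)
        where
        d = disagreement

        edge : Adjacent G (src e) (tgt e)
        edge = e , inj₁ refl

        short : k + suc l ≤ 2 * r + 1
        short = begin
          k + suc l    ≡⟨ ℕ.+-suc k l ⟩
          suc (k + l)  ≤⟨ s≤s (ℕ.+-mono-≤ k≤r l≤r) ⟩
          suc (r + r)  ≡⟨ ℕ.+-comm 1 (r + r) ⟩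
          r + r + 1    ≡⟨ cong (λ z → r + z + 1) (ℕ.+-identityʳ r) ⟨
          2 * r + 1    ∎
          where open ℕ.≤-Reasoning
        open ≡-Reasoning

      potential⇒Ball : ∀ {u} (x : Dec (Ball G r v u)) → potential x ≡ true → Ball G r v u
      potential⇒Ball (yes x) _ = x

      switch-disagreement : ∀ s t → t ≡ (if not (does (s Sign.≟ t)) then opposite s else s)
      switch-disagreement ⊕ ⊕ = refl
      switch-disagreement ⊕ ⊖ = refl
      switch-disagreement ⊖ ⊕ = refl
      switch-disagreement ⊖ ⊖ = refl

    -- Inside the ball the coboundary of the potential is the disagreement, so switching
    -- `potentialSet` turns `σ` into `τ` there.
    ball-switchingEquivalent : SwitchingEquivalentOn G (Ball G r v) σ τ
    ball-switchingEquivalent = potentialSet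
      , (λ u u∈S → potential⇒Ball (Ball? r v u) (trans (sym (lookup∘tabulate _ u)) ([]=⇒lookup u∈S)))
      , λ e x y → trans (switch-disagreement (σ e) (τ e))
          (cong (if_then opposite (σ e) else σ e) (sym (trans
            (cong₂ _xor_ (lookup∘tabulate _ (src e)) (lookup∘tabulate _ (tgt e)))
            (potential-edge e (Ball? r v (src e)) (Ball? r v (tgt e)) x y))))

  shorterThanCycles : ∀ {g b} → IsGirth G g → [ b ] <⁺ g → ∀ k → Cycle G k → b < k
  shorterThanCycles (_ , g≤) Strict⁺.[ b<g ]    k c = ℕ.<-≤-trans b<g (g≤ k c)
  shorterThanCycles acyclic  Strict⁺.[ _ ]<⊤⁺ k c = contradiction c (acyclic k)

  radiusStatisticsConstant : ∀ {g} a r → IsGirth G g → [ 2 * r + 1 ] <⁺ g →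
                             RadiusStatisticsConstant G a r
  radiusStatisticsConstant a r girth 2r+1<g X f local σ τ =
    local σ τ λ v → ball-switchingEquivalent (shorterThanCycles girth 2r+1<g) σ τ v

-- Min-plus factorizations

fromℕᵠ : ℕ → ℚ
fromℕᵠ k = ℤ.+ k ℚ./ 1

-- The quotient in `fromℕᵠ` is normalised, so the comparison passes to unnormalised fractions;
-- `mkℚᵘ z 0` is `z` over denominator 1.
fromℕᵠ-mono-≤ : ∀ {k l} → k ≤ l → fromℕᵠ k ℚ.≤ fromℕᵠ l
fromℕᵠ-mono-≤ {k} {l} k≤l = ℚ.toℚᵘ-cancel-≤ (begin
  ℚ.toℚᵘ (fromℕᵠ k)  ≃⟨ ℚ.toℚᵘ-fromℚᵘ (mkℚᵘ (ℤ.+ k) 0) ⟩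
  mkℚᵘ (ℤ.+ k) 0       ≤⟨ ℚᵘ.*≤* (ℤ.*-monoʳ-≤-nonNeg (ℤ.+ 1) (ℤ.+≤+ k≤l)) ⟩
  mkℚᵘ (ℤ.+ l) 0       ≃⟨ ℚ.toℚᵘ-fromℚᵘ (mkℚᵘ (ℤ.+ l) 0) ⟨
  ℚ.toℚᵘ (fromℕᵠ l)  ∎)
  where open ℚᵘ.≤-Reasoning

fromℕᵠ-+ : ∀ k l → fromℕᵠ (k + l) ≡ fromℕᵠ k ℚ.+ fromℕᵠ l
fromℕᵠ-+ k l = ℚ.toℚᵘ-injective (begin
  ℚ.toℚᵘ (fromℕᵠ (k + l))                    ≈⟨ ℚ.toℚᵘ-fromℚᵘ (mkℚᵘ (ℤ.+ (k + l)) 0) ⟩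
  mkℚᵘ (ℤ.+ (k + l)) 0                       ≈⟨ ℚᵘ.*≡* (cong (ℤ._* ℤ.+ 1)
    (cong₂ ℤ._+_ (sym (ℤ.*-identityʳ (ℤ.+ k))) (sym (ℤ.*-identityʳ (ℤ.+ l))))) ⟩
  mkℚᵘ (ℤ.+ k) 0 ℚᵘ.+ mkℚᵘ (ℤ.+ l) 0         ≈⟨ ℚᵘ.+-cong
    (ℚ.toℚᵘ-fromℚᵘ (mkℚᵘ (ℤ.+ k) 0)) (ℚ.toℚᵘ-fromℚᵘ (mkℚᵘ (ℤ.+ l) 0)) ⟨
  ℚ.toℚᵘ (fromℕᵠ k) ℚᵘ.+ ℚ.toℚᵘ (fromℕᵠ l)   ≈⟨ ℚ.toℚᵘ-homo-+ (fromℕᵠ k) (fromℕᵠ l) ⟨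
  ℚ.toℚᵘ (fromℕᵠ k ℚ.+ fromℕᵠ l)             ∎)
  where open import Relation.Binary.Reasoning.Setoid ℚᵘ.≃-setoid

-- Since `_⊓ʳ_` acts termwise, the inequality holds between the representing sequences at every
-- index, not merely between the reals.
minimum-≤ : ∀ {k} (f : Vector (ℝ ⁺) k) t {x} → f t ≡ [ x ] →
            ∃ λ z → minimum f ≡ [ z ] × (∀ i → seq z i ℚ.≤ seq x i)
minimum-≤ {suc k} f Fin.zero {x} eq rewrite eq with minimum (f ∘ Fin.suc)
... | [ y ] = x ⊓ʳ y , refl , λ i → ℚ.p⊓q≤p (seq x i) (seq y i)
... | ⊤⁺    = x , refl , λ i → ℚ.≤-refl
minimum-≤ {suc k} f (Fin.suc t) {x} eq with minimum-≤ (f ∘ Fin.suc) t eq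
... | z , eq′ , z≤x rewrite eq′ with f Fin.zero
... | [ y ] = y ⊓ʳ z , refl , λ i → ℚ.≤-trans (ℚ.p⊓q≤q (seq y i) (seq z i)) (z≤x i)
... | ⊤⁺    = z , refl , z≤x

-- The minimum of two rationals is one of them, so an attaining entry exists at each index `i`; it
-- may vary with `i`.
minimum-attained : ∀ {k} (f : Vector (ℝ ⁺) k) {z} → minimum f ≡ [ z ] → ∀ i →
                   ∃₂ λ t x → f t ≡ [ x ] × seq x i ≡ seq z i
minimum-attained {suc k} f eq i with f Fin.zero in f0 | minimum (f ∘ Fin.suc) in fs
minimum-attained {suc k} f refl i | [ x ] | ⊤⁺ = Fin.zero , x , f0 , refl
minimum-attained {suc k} f refl i | [ x ] | [ y ] with ℚ.⊓-sel (seq x i) (seq y i)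
... | inj₁ x⊓y≡x = Fin.zero , x , f0 , sym x⊓y≡x
... | inj₂ x⊓y≡y with minimum-attained (f ∘ Fin.suc) fs i
...   | t , y′ , ft , eq = Fin.suc t , y′ , ft , trans eq (sym x⊓y≡y)
minimum-attained {suc k} f refl i | ⊤⁺ | [ y ] with minimum-attained (f ∘ Fin.suc) fs i
... | t , y′ , ft , eq = Fin.suc t , y′ , ft , eq

≗⇒≈ : ∀ {x y} → (∀ i → seq x i ≡ seq y i) → x ≈ y
≗⇒≈ {x} {y} x≗y r 0<r = 0 , λ i _ → subst (ℚ._< r) (sym (∣x-y∣≡0 i)) 0<r
  where
  ∣x-y∣≡0 : ∀ i → ℚ.∣ seq x i ℚ.- seq y i ∣ ≡ 0ℚ
  ∣x-y∣≡0 i = cong ℚ.∣_∣ (trans (cong (ℚ._- seq y i) (x≗y i)) (ℚ.+-inverseʳ (seq y i)))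

≈⁺-minimum : ∀ {k} w (x : Fin k → ℝ) → (∀ t i → seq w i ℚ.≤ seq (x t) i) →
             ∀ t → (∀ i → seq (x t) i ≡ seq w i) → [ w ] ≈⁺ minimum (λ t → [ x t ])
≈⁺-minimum w x w≤x t x≗w with minimum-≤ (λ t → [ x t ]) t refl
... | z , eq , z≤x = subst ([ w ] ≈⁺_) (sym eq)
  Equality⁺.[ ≗⇒≈ {w} {z} (λ i → ℚ.≤-antisym (w≤z i) (subst (seq z i ℚ.≤_) (x≗w i) (z≤x i))) ]
  where
  w≤z : ∀ i → seq w i ℚ.≤ seq z i
  w≤z i with minimum-attained (λ t → [ x t ]) eq i
  ... | s , _ , refl , x≡z = subst (seq w i ℚ.≤_) x≡z (w≤x s i)

module _ {X Y : Set} (W : X → Y → ℕ) where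

  natural-factorization : ∀ {k} (a : Fin k → X → ℕ) (b : Fin k → Y → ℕ) →
                          (∀ x y t → W x y ≤ a t x + b t y) →
                          (∀ x y → ∃ λ t → a t x + b t y ≡ W x y) →
                          MinPlusFactorization W k
  natural-factorization a b W≤ attained =
    (λ t x → [ fromℕ (a t x) ]) , (λ t y → [ fromℕ (b t y) ]) , λ x y →
    ≈⁺-minimum (fromℕ (W x y)) (λ t → fromℕ (a t x) +ʳ fromℕ (b t y))
      (λ t _ → subst (fromℕᵠ (W x y) ℚ.≤_) (fromℕᵠ-+ (a t x) (b t y)) (fromℕᵠ-mono-≤ (W≤ x y t)))
      (proj₁ (attained x y))
      (λ _ → trans (sym (fromℕᵠ-+ (a _ x) (b _ y))) (cong fromℕᵠ (proj₂ (attained x y))))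

-- Lower bound on the rank from a fooling set

eventually-all : ∀ {k} (P : Fin k → ℕ → Set) → (∀ i → ∃ λ N → ∀ n → N ≤ n → P i n) →
                 ∃ λ N → ∀ n → N ≤ n → ∀ i → P i n
eventually-all {zero}  P h = 0 , λ _ _ ()
eventually-all {suc k} P h with h Fin.zero | eventually-all (P ∘ Fin.suc) (h ∘ Fin.suc)
... | M , f | N , g = M ⊔ N , λ
  { n M⊔N≤n Fin.zero    → f n (ℕ.m⊔n≤o⇒m≤o M N M⊔N≤n)
  ; n M⊔N≤n (Fin.suc i) → g n (ℕ.m⊔n≤o⇒n≤o M N M⊔N≤n) i }

p≤∣p∣ : ∀ p → p ℚ.≤ ℚ.∣ p ∣
p≤∣p∣ p with ℚ.≤-total 0ℚ p
... | inj₁ 0≤p = ℚ.≤-reflexive (sym (ℚ.0≤p⇒∣p∣≡p 0≤p))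
... | inj₂ p≤0 = ℚ.≤-trans p≤0 (ℚ.0≤∣p∣ p)

∣p-q∣<r⇒p<r+q : ∀ p q {r} → ℚ.∣ p ℚ.- q ∣ ℚ.< r → p ℚ.< r ℚ.+ q
∣p-q∣<r⇒p<r+q p q {r} h = subst (ℚ._< r ℚ.+ q) p-q+q≡p
  (ℚ.+-monoˡ-< q (ℚ.≤-<-trans (p≤∣p∣ (p ℚ.- q)) h))
  where
  p-q+q≡p : p ℚ.- q ℚ.+ q ≡ p
  p-q+q≡p = solve 2 (λ p q → p :- q :+ q := p) refl p q
    where open ℚ.+-*-Solver

∣p-q∣<r⇒q<r+p : ∀ p q {r} → ℚ.∣ p ℚ.- q ∣ ℚ.< r → q ℚ.< r ℚ.+ p
∣p-q∣<r⇒q<r+p p q {r} h = ∣p-q∣<r⇒p<r+q q p (subst (ℚ._< r) ∣p-q∣≡∣q-p∣ h)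
  where
  ∣p-q∣≡∣q-p∣ : ℚ.∣ p ℚ.- q ∣ ≡ ℚ.∣ q ℚ.- p ∣
  ∣p-q∣≡∣q-p∣ = trans (sym (ℚ.∣-p∣≡∣p∣ (p ℚ.- q))) (cong ℚ.∣_∣
    (solve 2 (λ p q → :- (p :- q) := q :- p) refl p q))
    where open ℚ.+-*-Solver

near-zero : ∀ {k q} → k ≡ 0 → ℚ.∣ fromℕᵠ k ℚ.- q ∣ ℚ.< ½ → q ℚ.< ½
near-zero {q = q} refl near = ∣p-q∣<r⇒q<r+p 0ℚ q near

-- If `q ≤ ½`, then `1 ≤ k < ½ + q ≤ 1`. Together with `near-zero`, the value `½` separates zero
-- entries from positive ones.
near-positive : ∀ {k q} → 1 ≤ k → ℚ.∣ fromℕᵠ k ℚ.- q ∣ ℚ.< ½ → ½ ℚ.< q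
near-positive {k} {q} 1≤k near = ℚ.≰⇒> λ q≤½ → ℚ.<-irrefl refl (ℚ.≤-<-trans (fromℕᵠ-mono-≤ 1≤k)
  (ℚ.<-≤-trans (∣p-q∣<r⇒p<r+q (fromℕᵠ k) q near) (ℚ.+-monoʳ-≤ ½ q≤½)))

+⁺-finite : ∀ {x y z} → x +⁺ y ≡ [ z ] →
            ∃₂ λ a b → x ≡ [ a ] × y ≡ [ b ] × z ≡ a +ʳ b
+⁺-finite {[ a ]} {[ b ]} refl = a , b , refl , refl , refl

≈⁺-finite : ∀ {x y} → [ x ] ≈⁺ y → ∃ λ z → y ≡ [ z ] × x ≈ z
≈⁺-finite Equality⁺.[ x≈z ] = _ , refl , x≈z

minimum-+⁺-attained : ∀ {l} (x y : Vector (ℝ ⁺) l) {z} →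
                      minimum (λ t → x t +⁺ y t) ≡ [ z ] → ∀ n →
                      ∃ λ t → ∃₂ λ a b → x t ≡ [ a ] × y t ≡ [ b ] × seq a n ℚ.+ seq b n ≡ seq z n
minimum-+⁺-attained x y eq n with minimum-attained (λ t → x t +⁺ y t) eq n
... | t , _ , x+y≡ , seq≡ with +⁺-finite {x t} x+y≡
...   | a , b , x≡ , y≡ , refl = t , a , b , x≡ , y≡ , seq≡

minimum-+⁺-≤ : ∀ {l} (x y : Vector (ℝ ⁺) l) {z} → minimum (λ t → x t +⁺ y t) ≡ [ z ] →
               ∀ {t a b} → x t ≡ [ a ] → y t ≡ [ b ] → ∀ n → seq z n ℚ.≤ seq a n ℚ.+ seq b n
minimum-+⁺-≤ x y eq {t} x≡ y≡ n with minimum-≤ (λ t → x t +⁺ y t) t (cong₂ _+⁺_ x≡ y≡)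
... | z′ , eq′ , z′≤ with trans (sym eq) eq′
...   | refl = z′≤ n

-- Both pairs of sums have the same total, which would lie both below and above `p + p`.
exchange-< : ∀ {a b a′ b′ p} → a ℚ.+ b ℚ.< p → a′ ℚ.+ b′ ℚ.< p →
             p ℚ.< a ℚ.+ b′ → ¬ (p ℚ.< a′ ℚ.+ b)
exchange-< {a} {b} {a′} {b′} {p} a+b<p a′+b′<p p<a+b′ p<a′+b =
  ℚ.<-irrefl refl (ℚ.<-trans (ℚ.+-mono-< p<a+b′ p<a′+b)
    (subst (ℚ._< p ℚ.+ p) exchange (ℚ.+-mono-< a+b<p a′+b′<p)))
  where
  exchange : (a ℚ.+ b) ℚ.+ (a′ ℚ.+ b′) ≡ (a ℚ.+ b′) ℚ.+ (a′ ℚ.+ b)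
  exchange = solve 4 (λ a b a′ b′ → (a :+ b) :+ (a′ :+ b′) := (a :+ b′) :+ (a′ :+ b))
               refl a b a′ b′
    where open ℚ.+-*-Solver

module _ {X Y : Set} (W : X → Y → ℕ) where

  -- Each diagonal zero selects a term that comes below `½` at a common index `n`. A term shared by
  -- `i` and `j` would also have its two crossed sums above `½`, against `exchange-<`; so the
  -- selection is injective.
  fooling-bound : ∀ {k l} (x : Fin k → X) (y : Fin k → Y) →
                  (∀ i → W (x i) (y i) ≡ 0) → (∀ {i j} → i ≢ j → 1 ≤ W (x i) (y j)) →
                  MinPlusFactorization W l → k ≤ l
  fooling-bound {k} {l} x y diagonal off-diagonal (u , v , W≈) =
    Fin.injective⇒≤ {f = λ i → proj₁ (diagonal-term i)} injective
    where
    term : Fin k → Fin k → Fin l → ℝ ⁺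
    term i j t = u t (x i) +⁺ v t (y j)

    -- Which term attains a real minimum is undecidable, but at an index n where all
    -- entries are approximated within ½ the minimum is one of rationals.
    Approximates : ∀ i j (n : ℕ) → Set
    Approximates i j n = ∃ λ z → minimum (term i j) ≡ [ z ] ×
                         ℚ.∣ fromℕᵠ (W (x i) (y j)) ℚ.- seq z n ∣ ℚ.< ½

    approximates : ∀ i j → ∃ λ N → ∀ n → N ≤ n → Approximates i j n
    approximates i j = let z , eq , W≈z = ≈⁺-finite (W≈ (x i) (y j))
                           N , near = W≈z ½ (ℚ.*<* (ℤ.+<+ (s≤s z≤n)))
                       in N , λ n N≤n → z , eq , near n N≤n

    index : ∃ λ N → ∀ n → N ≤ n → ∀ i j → Approximates i j n
    index = eventually-all (λ i n → ∀ j → Approximates i j n)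
              (λ i → eventually-all (Approximates i) (approximates i))

    n : ℕ
    n = proj₁ index

    approx : ∀ i j → Approximates i j n
    approx = proj₂ index n ℕ.≤-refl

    DiagonalTerm : Fin k → Fin l → Set
    DiagonalTerm i t = ∃₂ λ a b → u t (x i) ≡ [ a ] × v t (y i) ≡ [ b ] × seq a n ℚ.+ seq b n ℚ.< ½

    diagonal-term : ∀ i → ∃ (DiagonalTerm i)
    diagonal-term i =
      let z , eq , near = approx i i
          t , a , b , u≡ , v≡ , a+b≡z = minimum-+⁺-attained (λ t → u t (x i)) (λ t → v t (y i)) eq n
      in t , a , b , u≡ , v≡ , subst (ℚ._< ½) (sym a+b≡z) (near-zero (diagonal i) near)

    off-diagonal-term : ∀ {i j t a b} → i ≢ j → u t (x i) ≡ [ a ] → v t (y j) ≡ [ b ] →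
                        ½ ℚ.< seq a n ℚ.+ seq b n
    off-diagonal-term {i} {j} i≢j u≡ v≡ =
      let z , eq , near = approx i j
      in ℚ.<-≤-trans (near-positive (off-diagonal i≢j) near)
           (minimum-+⁺-≤ (λ t → u t (x i)) (λ t → v t (y j)) eq u≡ v≡ n)

    terms-distinct : ∀ {i j t} → i ≢ j → DiagonalTerm i t → ¬ DiagonalTerm j t
    terms-distinct i≢j (a , b , u≡ , v≡ , a+b<½) (a′ , b′ , u≡′ , v≡′ , a′+b′<½) =
      exchange-< {seq a n} {seq b n} {seq a′ n} {seq b′ n} a+b<½ a′+b′<½
        (off-diagonal-term i≢j u≡ v≡′) (off-diagonal-term (i≢j ∘ sym) u≡′ v≡)

    injective : ∀ {i j} → proj₁ (diagonal-term i) ≡ proj₁ (diagonal-term j) → i ≡ j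
    injective {i} {j} eq = decidable-stable (i Fin.≟ j) λ i≢j → terms-distinct i≢j
      (proj₂ (diagonal-term i)) (subst (DiagonalTerm j) (sym eq) (proj₂ (diagonal-term j)))

-- Subsets, weights and cuts

∉⇒outside : ∀ {n} {S : Subset n} {x} → x ∉ S → lookup S x ≡ false
∉⇒outside {S = S} {x} x∉S = ¬-not (x∉S ∘ lookup⇒[]= x S)

outside⇒∉ : ∀ {n} {S : Subset n} {x} → lookup S x ≡ false → x ∉ S
outside⇒∉ eq x∈S with trans (sym ([]=⇒lookup x∈S)) eq
... | ()

∣p∣≡1+∣p-x∣ : ∀ {n} {p : Subset n} {x} → x ∈ p → ∣ p ∣ ≡ suc ∣ p - x ∣
∣p∣≡1+∣p-x∣ {p = true ∷ p}  {zero}  Vec.here        = cong (suc ∘ ∣_∣) (sym (p─⊥≡p p))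
∣p∣≡1+∣p-x∣ {p = true ∷ p}  {suc x} (Vec.there x∈p) = cong suc (∣p∣≡1+∣p-x∣ x∈p)
∣p∣≡1+∣p-x∣ {p = false ∷ p} {suc x} (Vec.there x∈p) = ∣p∣≡1+∣p-x∣ x∈p

x∉p-x : ∀ {n} (p : Subset n) x → x ∉ p - x
x∉p-x (_ ∷ p) (suc x) (Vec.there x∈p-x) = x∉p-x p x x∈p-x
x∉p-x (true ∷ p)  zero ()
x∉p-x (false ∷ p) zero ()

element : ∀ {n} (P : Subset n) → Fin ∣ P ∣ → Fin n
element (true  ∷ P) zero    = zero
element (true  ∷ P) (suc i) = suc (element P i)
element (false ∷ P) i       = suc (element P i)

⁅element⁆⊆ : ∀ {n} (P : Subset n) i → ⁅ element P i ⁆ ⊆ P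
⁅element⁆⊆ P i x∈ = subst (_∈ P) (sym (x∈⁅y⁆⇒x≡y _ x∈)) (element∈ P i)
  where
  element∈ : ∀ {n} (P : Subset n) i → element P i ∈ P
  element∈ (true  ∷ P) zero    = Vec.here
  element∈ (true  ∷ P) (suc i) = Vec.there (element∈ P i)
  element∈ (false ∷ P) i       = Vec.there (element∈ P i)

-- Vectors indexed by Fin ∣ P ∣ stand for the subsets of P.
expand : ∀ {n} (P : Subset n) → Vector Bool ∣ P ∣ → Subset n
expand []          a = []
expand (true  ∷ P) a = a zero ∷ expand P (a ∘ suc)
expand (false ∷ P) a = false ∷ expand P a

restrict : ∀ {n} (P : Subset n) → Subset n → Vector Bool ∣ P ∣
restrict P S i = lookup S (element P i)

expand⊆ : ∀ {n} (P : Subset n) a → expand P a ⊆ P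
expand⊆ (true  ∷ P) a {zero}  _             = Vec.here
expand⊆ (true  ∷ P) a {suc x} (Vec.there h) = Vec.there (expand⊆ P (a ∘ suc) h)
expand⊆ (false ∷ P) a {suc x} (Vec.there h) = Vec.there (expand⊆ P a h)

lookup-expand-element : ∀ {n} (P : Subset n) a i → lookup (expand P a) (element P i) ≡ a i
lookup-expand-element (true  ∷ P) a zero    = refl
lookup-expand-element (true  ∷ P) a (suc i) = lookup-expand-element P (a ∘ suc) i
lookup-expand-element (false ∷ P) a i       = lookup-expand-element P a i

lookup-expand-restrict : ∀ {n} (P S : Subset n) {x} → x ∈ P →
                         lookup (expand P (restrict P S)) x ≡ lookup S x
lookup-expand-restrict (true  ∷ P) (_ ∷ S) {zero}  _             = refl
lookup-expand-restrict (true  ∷ P) (_ ∷ S) {suc x} (Vec.there h) = lookup-expand-restrict P S h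
lookup-expand-restrict (false ∷ P) (_ ∷ S) {suc x} (Vec.there h) = lookup-expand-restrict P S h

expand-cong : ∀ {n} (P : Subset n) {a b} → a ≗ b → expand P a ≡ expand P b
expand-cong []          a≗b = refl
expand-cong (true  ∷ P) a≗b = cong₂ _∷_ (a≗b zero) (expand-cong P (a≗b ∘ suc))
expand-cong (false ∷ P) a≗b = cong (false ∷_) (expand-cong P a≗b)

sum-zero : ∀ {k} {f : Vector Bool k} → (∀ i → f i ≡ false) → sum f ≡ false
sum-zero {k} f≗0 = trans (sum-cong-≗ f≗0) (sum-replicate-zero k)

-- Over the two-element field a subset of `P` is the sum of its singletons. Applying `δ` gives the
-- expansion of a cut into star cuts.
lookup-expand : ∀ {n} (P : Subset n) a x →
                lookup (expand P a) x ≡ sum (λ i → a i ∧ lookup ⁅ element P i ⁆ x)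
lookup-expand (true ∷ P) a zero = sym (trans
  (cong₂ _xor_ (∧-identityʳ (a zero)) (sum-zero λ i → ∧-zeroʳ (a (suc i)))) (xor-identityʳ (a zero)))
lookup-expand (true ∷ P) a (suc x) = trans (lookup-expand P (a ∘ suc) x)
  (cong (_xor sum (λ i → a (suc i) ∧ lookup ⁅ element P i ⁆ x))
    (sym (trans (cong (a zero ∧_) (lookup-replicate x outside)) (∧-zeroʳ (a zero)))))
lookup-expand (false ∷ P) a zero    = sym (sum-zero λ i → ∧-zeroʳ (a i))
lookup-expand (false ∷ P) a (suc x) = lookup-expand P a x

minOverSubsets-≤ : ∀ {n} (f : Subset n → ℕ) S → minOverSubsets f ≤ f S
minOverSubsets-≤ f []          = ℕ.≤-refl
minOverSubsets-≤ f (false ∷ S) = ℕ.≤-trans (ℕ.m⊓n≤m _ _) (minOverSubsets-≤ (f ∘ (outside ∷_)) S)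
minOverSubsets-≤ f (true ∷ S)  = ℕ.≤-trans (ℕ.m⊓n≤n (minOverSubsets (f ∘ (outside ∷_))) _)
  (minOverSubsets-≤ (f ∘ (inside ∷_)) S)

minOverSubsets-attained : ∀ {n} (f : Subset n → ℕ) → ∃ λ S → minOverSubsets f ≡ f S
minOverSubsets-attained {zero}  f = [] , refl
minOverSubsets-attained {suc n} f
  with ℕ.⊓-sel (minOverSubsets (f ∘ (outside ∷_))) (minOverSubsets (f ∘ (inside ∷_)))
... | inj₁ eq = let S , eq′ = minOverSubsets-attained (f ∘ (outside ∷_)) in _ , trans eq eq′
... | inj₂ eq = let S , eq′ = minOverSubsets-attained (f ∘ (inside ∷_)) in _ , trans eq eq′

weight-cong : ∀ {m} {c d : Vector Bool m} → c ≗ d → weight c ≡ weight d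
weight-cong c≗d = cong ∣_∣ (tabulate-cong c≗d)

weight-split : ∀ {m} (r c : Vector Bool m) →
               weight c ≡ weight (λ e → not (r e) ∧ c e) + weight (λ e → r e ∧ c e)
weight-split {zero}  r c = refl
weight-split {suc m} r c with r zero | c zero | weight-split (r ∘ suc) (c ∘ suc)
... | true  | true  | ih = trans (cong suc ih) (sym (ℕ.+-suc _ _))
... | false | true  | ih = cong suc ih
... | true  | false | ih = ih
... | false | false | ih = ih

weight≡0⇒ : ∀ {m} (c : Vector Bool m) → weight c ≡ 0 → ∀ e → c e ≡ false
weight≡0⇒ {suc m} c w≡0 e with c zero in c0
weight≡0⇒ {suc m} c w≡0 zero    | false = c0
weight≡0⇒ {suc m} c w≡0 (suc e) | false = weight≡0⇒ (c ∘ suc) w≡0 e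

weight-zero : ∀ {m} (c : Vector Bool m) → (∀ e → c e ≡ false) → weight c ≡ 0
weight-zero {zero}  c c≗0 = refl
weight-zero {suc m} c c≗0 rewrite c≗0 zero = weight-zero (c ∘ suc) (c≗0 ∘ suc)

-- Cuts and bases of star cuts

module _ {n m : ℕ} (G : Graph n m) where

  open Graph G

  δ-cong : ∀ S T → lookup S ≗ lookup T → δ G S ≗ δ G T
  δ-cong S T S≗T e = cong₂ _xor_ (S≗T (src e)) (S≗T (tgt e))

  δ-∁ : ∀ S → δ G S ≗ δ G (∁ S)
  δ-∁ S e = sym (trans (cong₂ _xor_ (lookup-map (src e) not S) (lookup-map (tgt e) not S))
    (xor-annihilates-not (lookup S (src e)) (lookup S (tgt e))))

  δ-⊥ : ∀ e → δ G ⊥ e ≡ false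
  δ-⊥ e = cong₂ _xor_ (lookup-replicate (src e) outside) (lookup-replicate (tgt e) outside)

  -- Complementary sets have the same cut, and one of them misses `b`. This normalises the
  -- representatives of cuts.
  cut-avoiding : ∀ b S → ∃ λ T → b ∉ T × δ G S ≗ δ G T
  cut-avoiding b S with b ∈? S
  ... | no b∉S  = S , b∉S , λ _ → refl
  ... | yes b∈S = ∁ S , x∈p⇒x∉∁p b∈S , δ-∁ S

  -- Connectedness as it is used below: a function with zero coboundary inside `A` is constant on
  -- `A`. It is applied to membership functions and to the `xor` of two of them.
  constant-on : ∀ {A} → ConnectedOn G A → (h : Fin n → Bool) →
                (∀ e → src e ∈ A → tgt e ∈ A → h (src e) ≡ h (tgt e)) →
                ∀ {u v} → u ∈ A → v ∈ A → h u ≡ h v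
  constant-on {A} (_ , connected) h h-edge u∈A v∈A = along (connected _ _ u∈A v∈A)
    where
    along : ∀ {u v} → Star (λ x y → x ∈ A × y ∈ A × Adjacent G x y) u v → h u ≡ h v
    along ε = refl
    along ((x∈A , y∈A , e , inj₁ refl) ◅ p) = trans (h-edge e x∈A y∈A) (along p)
    along ((x∈A , y∈A , e , inj₂ refl) ◅ p) = trans (sym (h-edge e y∈A x∈A)) (along p)

  starCuts : (P : Subset n) → Fin ∣ P ∣ → Vector Bool m
  starCuts P i = δ G ⁅ element P i ⁆

  combination-starCuts : ∀ P a → combination a (starCuts P) ≗ δ G (expand P a)
  combination-starCuts P a e = begin
    sum (λ i → a i ∧ (lookup ⁅ element P i ⁆ (src e) xor lookup ⁅ element P i ⁆ (tgt e)))
      ≡⟨ sum-cong-≗ (λ i → ∧-distribˡ-xor (a i) _ _) ⟩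
    sum (λ i → (a i ∧ lookup ⁅ element P i ⁆ (src e)) xor (a i ∧ lookup ⁅ element P i ⁆ (tgt e)))
      ≡⟨ ∑-distrib-+ (λ i → a i ∧ lookup ⁅ element P i ⁆ (src e)) _ ⟩
    sum (λ i → a i ∧ lookup ⁅ element P i ⁆ (src e)) xor sum (λ i → a i ∧ lookup ⁅ element P i ⁆ (tgt e))
      ≡⟨ cong₂ _xor_ (lookup-expand P a (src e)) (lookup-expand P a (tgt e)) ⟨
    δ G (expand P a) e ∎
    where open ≡-Reasoning

  -- A vanishing combination is the cut of `expand P a`, whose membership function is then constant;
  -- it is false at `b`, so all coefficients vanish. Leaving `U` abstract lets one argument serve
  -- the cut space and both of its subspaces.
  starCuts-dimension : Connected G → ∀ P {b} → b ∉ P → ∀ {U} →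
                       (∀ S → S ⊆ P → U (δ G S)) →
                       (∀ c → U c → ∃ λ S → S ⊆ P × c ≗ δ G S) →
                       HasDimension U ∣ P ∣
  starCuts-dimension connected P {b} b∉P contains contained =
    starCuts P , (λ i → contains _ (⁅element⁆⊆ P i)) , independent , spans
    where
    independent : LinearlyIndependent (starCuts P)
    independent a vanishes i = begin
      a i                                 ≡⟨ lookup-expand-element P a i ⟨
      lookup (expand P a) (element P i)   ≡⟨ constant-on connected (lookup (expand P a))
        (λ e _ _ → xor≡false⇒≡ _ _ (trans (sym (combination-starCuts P a e)) (vanishes e))) ∈⊤ ∈⊤ ⟩
      lookup (expand P a) b               ≡⟨ ∉⇒outside (b∉P ∘ expand⊆ P a) ⟩
      false                               ∎
      where open ≡-Reasoning

    lookup-expand-restrict-⊆ : ∀ {S} → S ⊆ P → lookup S ≗ lookup (expand P (restrict P S))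
    lookup-expand-restrict-⊆ {S} S⊆P x with x ∈? P
    ... | yes x∈P = sym (lookup-expand-restrict P S x∈P)
    ... | no x∉P  = trans (∉⇒outside (x∉P ∘ S⊆P)) (sym (∉⇒outside (x∉P ∘ expand⊆ P _)))

    spans : Spans (starCuts P) _
    spans c Uc = let S , S⊆P , c≗δS = contained c Uc in
      restrict P S , λ e → trans (c≗δS e) (trans (δ-cong S (expand P (restrict P S)) (lookup-expand-restrict-⊆ S⊆P) e)
        (sym (combination-starCuts P (restrict P S) e)))

-- The ground-state matrix across a dominating partition

funToFin-cong : ∀ {k l} {f g : Fin k → Fin l} → f ≗ g → Fin.funToFin f ≡ Fin.funToFin g
funToFin-cong {zero}  f≗g = refl
funToFin-cong {suc k} f≗g = cong₂ Fin.combine (f≗g zero) (funToFin-cong (f≗g ∘ suc))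

module _ {k : ℕ} where

  -- Terms of a factorization are numbered by `Fin`, so the traces, which are binary words, are
  -- numbered by this bijection.
  toBits : Fin (2 ^ k) → Vector Bool k
  toBits t = Inverse.to Fin.2↔Bool ∘ Fin.finToFun {2} {k} t

  fromBits : Vector Bool k → Fin (2 ^ k)
  fromBits a = Fin.funToFin (Inverse.from Fin.2↔Bool ∘ a)

  toBits-fromBits : ∀ a → toBits (fromBits a) ≗ a
  toBits-fromBits a i = trans (cong (Inverse.to Fin.2↔Bool) (Fin.finToFun-funToFin (Inverse.from Fin.2↔Bool ∘ a) i))
    (Inverse.strictlyInverseˡ Fin.2↔Bool (a i))

  fromBits-toBits : ∀ t → fromBits (toBits t) ≡ t
  fromBits-toBits t = trans
    (funToFin-cong (Inverse.strictlyInverseʳ Fin.2↔Bool ∘ Fin.finToFun {2} {k} t))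
    (Fin.funToFin-finToFin {k} t)

  toBits-injective : ∀ {s t} → toBits s ≗ toBits t → s ≡ t
  toBits-injective {s} {t} s≗t = trans (sym (fromBits-toBits s))
    (trans (funToFin-cong (cong (Inverse.from Fin.2↔Bool) ∘ s≗t)) (fromBits-toBits t))

-- At an edge this converts agreement of `δ S` and `δ T` into equality of the difference of `S` and
-- `T` at the two ends, and back again.
xor-exchange : ∀ a b c d → a xor b ≡ c xor d → a xor c ≡ b xor d
xor-exchange false false false false _ = refl
xor-exchange false false true  true  _ = refl
xor-exchange false true  false true  _ = refl
xor-exchange false true  true  false _ = refl
xor-exchange true  false false true  _ = refl
xor-exchange true  false true  false _ = refl
xor-exchange true  true  false false _ = refl
xor-exchange true  true  true  true  _ = refl

∧-congˡ-true : ∀ b {x y} → (b ≡ true → x ≡ y) → b ∧ x ≡ b ∧ y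
∧-congˡ-true true  x≡y = x≡y refl
∧-congˡ-true false _   = refl

-- Allows `B` to be replaced by `∁ A`, so that membership in `B` is computed from `A`.
partition⇒∁ : ∀ {n} {A B : Subset n} → Partition A B → B ≡ ∁ A
partition⇒∁ {A = A} {B} p = ⊆-antisym B⊆∁A ∁A⊆B
  where
  B⊆∁A : B ⊆ ∁ A
  B⊆∁A x∈B = x∉p⇒x∈∁p λ x∈A →
    ∉⊥ (subst (_ ∈_) (Partition.disjoint p) (x∈p∩q⁺ (x∈A , x∈B)))

  ∁A⊆B : ∁ A ⊆ B
  ∁A⊆B x∈∁A with x∈p∪q⁻ A B (subst (_ ∈_) (sym (Partition.cover p)) ∈⊤)
  ... | inj₁ x∈A = contradiction x∈A (x∈∁p⇒x∉p x∈∁A)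
  ... | inj₂ x∈B = x∈B

module _ {n m : ℕ} (G : Graph n m) (A : Subset n) where

  open Graph G

  private
    B : Subset n
    B = ∁ A

    E-L E-R : Subset m
    E-L = edgesInside G A ∪ edgesBetween G A B
    E-R = edgesInside G B

  ∈E-R⁻ : ∀ {e} → e ∈ E-R → src e ∈ B × tgt e ∈ B
  ∈E-R⁻ {e} e∈ with lookup B (src e) in s | lookup B (tgt e) in t
                  | trans (sym (lookup∘tabulate _ e)) ([]=⇒lookup e∈)
  ... | true | true | _ = lookup⇒[]= _ B s , lookup⇒[]= _ B t

  -- After writing `B` as the complement of `A`, a truth table in the two bits of the ends.
  -- Complementarity makes the last clause of `glue` unreachable.
  lookup-E-L : ∀ e → lookup E-L e ≡ not (lookup E-R e)
  lookup-E-L e = begin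
    lookup E-L e
      ≡⟨ lookup-zipWith _∨_ e (edgesInside G A) (edgesBetween G A B) ⟩
    lookup (edgesInside G A) e ∨ lookup (edgesBetween G A B) e
      ≡⟨ cong₂ _∨_ (lookup∘tabulate _ e) (lookup∘tabulate _ e) ⟩
    (a ∧ a′) ∨ ((a ∧ lookup B (tgt e)) ∨ (lookup B (src e) ∧ a′))
      ≡⟨ cong₂ (λ b b′ → (a ∧ a′) ∨ ((a ∧ b′) ∨ (b ∧ a′))) (lookup-map (src e) not A) (lookup-map (tgt e) not A) ⟩
    (a ∧ a′) ∨ ((a ∧ not a′) ∨ (not a ∧ a′))
      ≡⟨ cases a a′ ⟩
    not (not a ∧ not a′)
      ≡⟨ cong₂ (λ b b′ → not (b ∧ b′)) (lookup-map (src e) not A) (lookup-map (tgt e) not A) ⟨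
    not (lookup B (src e) ∧ lookup B (tgt e))
      ≡⟨ cong not (lookup∘tabulate _ e) ⟨
    not (lookup E-R e) ∎
    where
    open ≡-Reasoning
    a a′ : Bool
    a  = lookup A (src e)
    a′ = lookup A (tgt e)

    cases : ∀ a a′ → (a ∧ a′) ∨ ((a ∧ not a′) ∨ (not a ∧ a′)) ≡ not (not a ∧ not a′)
    cases true  true  = refl
    cases true  false = refl
    cases false true  = refl
    cases false false = refl

  ∉E-R⇒∈E-L : ∀ {e} → e ∉ E-R → e ∈ E-L
  ∉E-R⇒∈E-L {e} e∉ = lookup⇒[]= e E-L (trans (lookup-E-L e) (cong not (∉⇒outside e∉)))

  ∈E-R⇒∉E-L : ∀ {e} → e ∈ E-R → e ∉ E-L
  ∈E-R⇒∉E-L {e} e∈ = outside⇒∉ (trans (lookup-E-L e) (cong not ([]=⇒lookup e∈)))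

  src∈A⇒∈E-L : ∀ {e} → src e ∈ A → e ∈ E-L
  src∈A⇒∈E-L src∈A = ∉E-R⇒∈E-L λ e∈ → x∈∁p⇒x∉p (proj₁ (∈E-R⁻ e∈)) src∈A

  tgt∈A⇒∈E-L : ∀ {e} → tgt e ∈ A → e ∈ E-L
  tgt∈A⇒∈E-L tgt∈A = ∉E-R⇒∈E-L λ e∈ → x∈∁p⇒x∉p (proj₂ (∈E-R⁻ e∈)) tgt∈A

  glue-cong : ∀ {ωL ωL′ : 𝔽₂^ G E-L} {ωR ωR′ : 𝔽₂^ G E-R} e →
              ((e∈ : e ∈ E-L) → ωL e e∈ ≡ ωL′ e e∈) → ((e∈ : e ∈ E-R) → ωR e e∈ ≡ ωR′ e e∈) →
              glue G ωL ωR e ≡ glue G ωL′ ωR′ e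
  glue-cong e ωL≡ ωR≡ with e ∈? E-L | e ∈? E-R
  ... | yes e∈L | _       = ωL≡ e∈L
  ... | no _    | yes e∈R = ωR≡ e∈R
  ... | no _    | no _    = refl

  glue-restrictions : ∀ (c d : Vector Bool m) e →
    glue G {E-L} {E-R} (λ e _ → c e) (λ e _ → d e) e ≡ (if lookup E-R e then d e else c e)
  glue-restrictions c d e with e ∈? E-L | e ∈? E-R
  ... | yes e∈L | yes e∈R = contradiction e∈L (∈E-R⇒∉E-L e∈R)
  ... | yes _   | no e∉R  = cong (if_then d e else c e) (sym (∉⇒outside e∉R))
  ... | no _    | yes e∈R = cong (if_then d e else c e) (sym ([]=⇒lookup e∈R))
  ... | no e∉L  | no e∉R  = contradiction (∉E-R⇒∈E-L e∉R) e∉L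

  module _ (connected : Connected G) (A-connected : ConnectedOn G A) (B-connected : ConnectedOn G B)
           (A-dominates : ∀ b → b ∈ B → ∃ λ x → x ∈ A × Adjacent G b x) where

    private
      b₀ : Fin n
      b₀ = proj₁ (proj₁ B-connected)

      b₀∈B : b₀ ∈ B
      b₀∈B = proj₂ (proj₁ B-connected)

      -- Subsets of `B⁻` are the traces on `B` taken up to complement; they index the terms of the
      -- factorization.
      B⁻ : Subset n
      B⁻ = B - b₀

      b₀∉B⁻ : b₀ ∉ B⁻
      b₀∉B⁻ = x∉p-x B b₀

    -- The graph with edge set `E-L` is connected: edges inside `A` connect `A`, and domination
    -- joins each vertex of `B` to `A` by an edge of `E-L`.
    E-L-connected : (h : Fin n → Bool) → (∀ e → e ∈ E-L → h (src e) ≡ h (tgt e)) →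
                    ∀ u v → h u ≡ h v
    E-L-connected h h-edge u v = trans (to-A u) (sym (to-A v))
      where
      a₀ : Fin n
      a₀ = proj₁ (proj₁ A-connected)

      on-A : ∀ {u} → u ∈ A → h u ≡ h a₀
      on-A u∈A = constant-on G A-connected h (λ e src∈A _ → h-edge e (src∈A⇒∈E-L src∈A))
        u∈A (proj₂ (proj₁ A-connected))

      to-A : ∀ u → h u ≡ h a₀
      to-A u with u ∈? A
      ... | yes u∈A = on-A u∈A
      ... | no u∉A with A-dominates u (x∉p⇒x∈∁p u∉A)
      ...   | x , x∈A , e , inj₁ refl = trans (h-edge e (tgt∈A⇒∈E-L x∈A)) (on-A x∈A)
      ...   | x , x∈A , e , inj₂ refl = trans (sym (h-edge e (src∈A⇒∈E-L x∈A))) (on-A x∈A)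

    -- The difference of `S` and `T` is constant along `E-L`, hence on all vertices, so `S` and `T`
    -- are equal or complementary.
    cut-determined-by-E-L : ∀ S T → (∀ e → e ∈ E-L → δ G S e ≡ δ G T e) → δ G S ≗ δ G T
    cut-determined-by-E-L S T δS≡δT e =
      xor-exchange (lookup S (src e)) (lookup T (src e)) (lookup S (tgt e)) (lookup T (tgt e))
        (E-L-connected (λ x → lookup S x xor lookup T x)
          (λ e e∈ → xor-exchange (lookup S (src e)) (lookup S (tgt e)) (lookup T (src e)) (lookup T (tgt e)) (δS≡δT e e∈))
          (src e) (tgt e))

    -- The difference of `S` and `T` is constant on the connected set `B` and vanishes at `b₀`.
    cuts-agreeing-on-E-R : ∀ S T → b₀ ∉ S → b₀ ∉ T → (∀ e → e ∈ E-R → δ G S e ≡ δ G T e) →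
                           ∀ {x} → x ∈ B → lookup S x ≡ lookup T x
    cuts-agreeing-on-E-R S T b₀∉S b₀∉T δS≡δT {x} x∈B = xor≡false⇒≡ _ _ (begin
      lookup S x xor lookup T x    ≡⟨ constant-on G B-connected (λ x → lookup S x xor lookup T x) edge x∈B b₀∈B ⟩
      lookup S b₀ xor lookup T b₀  ≡⟨ cong₂ _xor_ (∉⇒outside b₀∉S) (∉⇒outside b₀∉T) ⟩
      false                        ∎)
      where
      open ≡-Reasoning
      edge : ∀ e → src e ∈ B → tgt e ∈ B →
             lookup S (src e) xor lookup T (src e) ≡ lookup S (tgt e) xor lookup T (tgt e)
      edge e s∈B t∈B = xor-exchange (lookup S (src e)) (lookup S (tgt e)) (lookup T (src e)) (lookup T (tgt e))
        (δS≡δT e (lookup⇒[]= e E-R (trans (lookup∘tabulate _ e)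
          (cong₂ _∧_ ([]=⇒lookup s∈B) ([]=⇒lookup t∈B)))))

    private
      W : 𝔽₂^ G E-L → 𝔽₂^ G E-R → ℕ
      W = groundStateMatrix G E-L E-R

      energy : 𝔽₂^ G E-L → 𝔽₂^ G E-R → Subset n → ℕ
      energy ωL ωR S = weight λ e → glue G ωL ωR e xor δ G S e

      -- The zeros glued in on `E-R` are erased by the mask; they make the expression depend on `ωL`
      -- alone. `energyR` is built the same way.
      energyL : 𝔽₂^ G E-L → Subset n → ℕ
      energyL ωL S = weight λ e → not (lookup E-R e) ∧ (glue G {R = E-R} ωL (λ _ _ → false) e xor δ G S e)

      energyR : 𝔽₂^ G E-R → Subset n → ℕ
      energyR ωR S = weight λ e → lookup E-R e ∧ (glue G {E-L} (λ _ _ → false) ωR e xor δ G S e)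

      energy-split : ∀ ωL ωR S → energy ωL ωR S ≡ energyL ωL S + energyR ωR S
      energy-split ωL ωR S = trans (weight-split (lookup E-R) _)
        (cong₂ _+_ (weight-cong left) (weight-cong right))
        where
        left : ∀ e → not (lookup E-R e) ∧ (glue G ωL ωR e xor δ G S e) ≡
                     not (lookup E-R e) ∧ (glue G {R = E-R} ωL (λ _ _ → false) e xor δ G S e)
        left e = ∧-congˡ-true (not (lookup E-R e)) λ e∉R → cong (_xor δ G S e)
          (glue-cong e (λ _ → refl) λ e∈R →
            contradiction (lookup⇒[]= e E-L (trans (lookup-E-L e) e∉R)) (∈E-R⇒∉E-L e∈R))

        right : ∀ e → lookup E-R e ∧ (glue G ωL ωR e xor δ G S e) ≡
                      lookup E-R e ∧ (glue G {E-L} (λ _ _ → false) ωR e xor δ G S e)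
        right e = ∧-congˡ-true (lookup E-R e) λ e∈R → cong (_xor δ G S e)
          (glue-cong e (λ e∈L → contradiction e∈L (∈E-R⇒∉E-L (lookup⇒[]= e E-R e∈R))) (λ _ → refl))

      -- Both ends of an edge of `E-R` lie in `B`, so only the trace on `B` matters. Fixing the
      -- trace therefore decouples the two energies.
      energyR-cong : ∀ ωR S T → (∀ {x} → x ∈ B → lookup S x ≡ lookup T x) →
                     energyR ωR S ≡ energyR ωR T
      energyR-cong ωR S T S≡T = weight-cong λ e → ∧-congˡ-true (lookup E-R e) λ e∈R →
        let s∈B , t∈B = ∈E-R⁻ (lookup⇒[]= e E-R e∈R)
        in cong (glue G {E-L} (λ _ _ → false) ωR e xor_) (cong₂ _xor_ (S≡T s∈B) (S≡T t∈B))

      trace : Fin (2 ^ ∣ B⁻ ∣) → Subset n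
      trace t = expand B⁻ (toBits t)

      b₀∉trace : ∀ t → b₀ ∉ trace t
      b₀∉trace t = b₀∉B⁻ ∘ expand⊆ B⁻ (toBits t)

      extend : Subset n → Subset n → Subset n
      extend T S = tabulate λ x → if lookup A x then lookup S x else lookup T x

      extend-B : ∀ T S {x} → x ∈ B → lookup (extend T S) x ≡ lookup T x
      extend-B T S {x} x∈B = trans (lookup∘tabulate _ x)
        (cong (if_then lookup S x else lookup T x) (∉⇒outside (x∈∁p⇒x∉p x∈B)))

      extend-trace : ∀ T S → (∀ {x} → x ∈ B → lookup T x ≡ lookup S x) → lookup (extend T S) ≗ lookup S
      extend-trace T S T≡S x with x ∈? A
      ... | yes x∈A = trans (lookup∘tabulate _ x) (cong (if_then lookup S x else lookup T x) ([]=⇒lookup x∈A))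
      ... | no x∉A  = trans (extend-B T S (x∉p⇒x∈∁p x∉A)) (T≡S (x∉p⇒x∈∁p x∉A))

      trace-surjective : ∀ S → b₀ ∉ S → ∃ λ t → ∀ {x} → x ∈ B → lookup (trace t) x ≡ lookup S x
      trace-surjective S b₀∉S = t , agree
        where
        t : Fin (2 ^ ∣ B⁻ ∣)
        t = fromBits (restrict B⁻ S)

        agree : ∀ {x} → x ∈ B → lookup (trace t) x ≡ lookup S x
        agree {x} x∈B with x Fin.≟ b₀
        ... | yes refl = trans (∉⇒outside (b₀∉trace t)) (sym (∉⇒outside b₀∉S))
        ... | no x≢b₀  = trans (cong (λ T → lookup T x) (expand-cong B⁻ (toBits-fromBits (restrict B⁻ S))))
                           (lookup-expand-restrict B⁻ S (x∈p∧x≢y⇒x∈p-y x∈B x≢b₀))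

      -- The best completion of the trace on `A`. As `extend` overwrites `S` on `B`, minimising over
      -- all subsets of vertices amounts to minimising over subsets of `A`.
      u : Fin (2 ^ ∣ B⁻ ∣) → 𝔽₂^ G E-L → ℕ
      u t ωL = minOverSubsets λ S → energyL ωL (extend (trace t) S)

      v : Fin (2 ^ ∣ B⁻ ∣) → 𝔽₂^ G E-R → ℕ
      v t ωR = energyR ωR (trace t)

      W≤u+v : ∀ ωL ωR t → W ωL ωR ≤ u t ωL + v t ωR
      W≤u+v ωL ωR t with minOverSubsets-attained (λ S → energyL ωL (extend (trace t) S))
      ... | S , u≡ = begin
        W ωL ωR                                        ≤⟨ minOverSubsets-≤ (energy ωL ωR) S′ ⟩
        energy ωL ωR S′                                ≡⟨ energy-split ωL ωR S′ ⟩
        energyL ωL S′ + energyR ωR S′                  ≡⟨ cong₂ _+_ (sym u≡)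
          (energyR-cong ωR S′ (trace t) (extend-B (trace t) S)) ⟩
        u t ωL + v t ωR                                ∎
        where
        open ℕ.≤-Reasoning
        S′ = extend (trace t) S

      u+v-attains-W : ∀ ωL ωR → ∃ λ t → u t ωL + v t ωR ≡ W ωL ωR
      u+v-attains-W ωL ωR with minOverSubsets-attained (energy ωL ωR)
      ... | S , W≡ with cut-avoiding G b₀ S
      -- The minimiser is replaced by a set with the same cut that avoids `b₀`, so that its trace is
      -- among those enumerated.
      ...   | T , b₀∉T , δS≗δT with trace-surjective T b₀∉T
      ...     | t , agree = t , ℕ.≤-antisym u+v≤W (W≤u+v ωL ωR t)
        where
        open ℕ.≤-Reasoning
        T′ = extend (trace t) T

        u+v≤W : u t ωL + v t ωR ≤ W ωL ωR
        u+v≤W = begin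
          u t ωL + v t ωR
            ≤⟨ ℕ.+-monoˡ-≤ (v t ωR) (minOverSubsets-≤ (λ S → energyL ωL (extend (trace t) S)) T) ⟩
          energyL ωL T′ + v t ωR
            ≡⟨ cong₂ _+_
                 (weight-cong λ e → cong (λ z → not (lookup E-R e) ∧ (glue G {R = E-R} ωL (λ _ _ → false) e xor z))
                   (δ-cong G T′ T (extend-trace (trace t) T agree) e))
                 (energyR-cong ωR (trace t) T agree) ⟩
          energyL ωL T + energyR ωR T
            ≡⟨ energy-split ωL ωR T ⟨
          energy ωL ωR T
            ≡⟨ weight-cong (λ e → cong (glue G ωL ωR e xor_) (δS≗δT e)) ⟨
          energy ωL ωR S
            ≡⟨ W≡ ⟨
          W ωL ωR ∎

      -- The fooling set consists of the rows and columns obtained by restricting the cuts of the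
      -- traces to `E-L` and `E-R`.
      restrictL : Fin (2 ^ ∣ B⁻ ∣) → 𝔽₂^ G E-L
      restrictL i e _ = δ G (trace i) e

      restrictR : Fin (2 ^ ∣ B⁻ ∣) → 𝔽₂^ G E-R
      restrictR i e _ = δ G (trace i) e

      W-diagonal : ∀ i → W (restrictL i) (restrictR i) ≡ 0
      W-diagonal i = ℕ.n≤0⇒n≡0 (ℕ.≤-trans
        (minOverSubsets-≤ (energy (restrictL i) (restrictR i)) (trace i))
        (ℕ.≤-reflexive (weight-zero _ λ e → begin
          glue G (restrictL i) (restrictR i) e xor δ G (trace i) e
            ≡⟨ cong (_xor δ G (trace i) e) (glue-restrictions (δ G (trace i)) (δ G (trace i)) e) ⟩
          (if lookup E-R e then δ G (trace i) e else δ G (trace i) e) xor δ G (trace i) e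
            ≡⟨ cong (_xor δ G (trace i) e) (if-eta (lookup E-R e)) ⟩
          δ G (trace i) e xor δ G (trace i) e
            ≡⟨ xor-same (δ G (trace i) e) ⟩
          false ∎)))
        where open ≡-Reasoning

      -- A zero entry says that the glued vector is a cut `δ S`. Agreement on `E-L` forces this cut
      -- to be that of `trace i` everywhere; agreement on `E-R` then identifies the two traces on
      -- `B`.
      W≡0⇒ : ∀ {i j} → W (restrictL i) (restrictR j) ≡ 0 → i ≡ j
      W≡0⇒ {i} {j} W≡0 with minOverSubsets-attained (energy (restrictL i) (restrictR j))
      ... | S , W≡ = toBits-injective λ x → begin
        toBits i x                                ≡⟨ lookup-expand-element B⁻ (toBits i) x ⟨
        lookup (trace i) (element B⁻ x)           ≡⟨ cuts-agreeing-on-E-R (trace i) (trace j) (b₀∉trace i) (b₀∉trace j)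
          (λ e e∈R → trans (δi≗δS e) (sym (onR e e∈R))) (p─q⊆p B ⁅ b₀ ⁆ (⁅element⁆⊆ B⁻ x (x∈⁅x⁆ _))) ⟩
        lookup (trace j) (element B⁻ x)           ≡⟨ lookup-expand-element B⁻ (toBits j) x ⟩
        toBits j x                                ∎
        where
        open ≡-Reasoning

        glue≡δS : ∀ e → (if lookup E-R e then δ G (trace j) e else δ G (trace i) e) ≡ δ G S e
        glue≡δS e = trans (sym (glue-restrictions (δ G (trace i)) (δ G (trace j)) e))
          (xor≡false⇒≡ _ _ (weight≡0⇒ (λ e → glue G (restrictL i) (restrictR j) e xor δ G S e)
            (trans (sym W≡) W≡0) e))

        onR : ∀ e → e ∈ E-R → δ G (trace j) e ≡ δ G S e
        onR e e∈R = subst (λ b → (if b then δ G (trace j) e else δ G (trace i) e) ≡ δ G S e)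
          ([]=⇒lookup e∈R) (glue≡δS e)

        δi≗δS : δ G (trace i) ≗ δ G S
        δi≗δS = cut-determined-by-E-L (trace i) S λ e e∈L →
          subst (λ b → (if b then δ G (trace j) e else δ G (trace i) e) ≡ δ G S e)
            (∉⇒outside (λ e∈R → ∈E-R⇒∉E-L e∈R e∈L)) (glue≡δS e)

    ∣B∣≡1+∣B⁻∣ : ∣ B ∣ ≡ suc ∣ B⁻ ∣
    ∣B∣≡1+∣B⁻∣ = ∣p∣≡1+∣p-x∣ b₀∈B

    groundStateMatrix-rank : IsMinPlusRank W (2 ^ (∣ B ∣ ∸ 1))
    groundStateMatrix-rank = subst (λ k → IsMinPlusRank W (2 ^ (k ∸ 1))) (sym ∣B∣≡1+∣B⁻∣)
      ( natural-factorization W u v W≤u+v u+v-attains-W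
      , λ l → fooling-bound W restrictL restrictR W-diagonal
                (λ i≢j → ℕ.n≢0⇒n>0 (i≢j ∘ W≡0⇒)))

    -- Dimensions of the cut spaces and the state complexity

    dim-CutSpace : HasDimension (CutSpace G) ∣ ⊤ - b₀ ∣
    dim-CutSpace = starCuts-dimension G connected (⊤ - b₀) (x∉p-x ⊤ b₀)
      (λ S _ → S , λ _ → refl)
      (λ c (S , c≗δS) → let T , b₀∉T , δS≗δT = cut-avoiding G b₀ S in
        T , (λ x∈T → x∈p∧x≢y⇒x∈p-y ∈⊤ λ { refl → b₀∉T x∈T }) , λ e → trans (c≗δS e) (δS≗δT e))

    -- A set inside `A` cuts no edge inside `B`. Conversely, a cut vanishing on `E-R` agrees there
    -- with `δ ⊥`, so its representative avoiding `b₀` misses all of `B`.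
    dim-vanishing-on-E-R : HasDimension (CutSpaceVanishingOn G E-R) ∣ A ∣
    dim-vanishing-on-E-R = starCuts-dimension G connected A (x∈∁p⇒x∉p b₀∈B)
      (λ S S⊆A → (S , λ _ → refl) , λ e e∈R →
        cong₂ _xor_ (∉⇒outside (x∈∁p⇒x∉p (proj₁ (∈E-R⁻ e∈R)) ∘ S⊆A))
                    (∉⇒outside (x∈∁p⇒x∉p (proj₂ (∈E-R⁻ e∈R)) ∘ S⊆A)))
      contained
      where
      contained : ∀ c → CutSpaceVanishingOn G E-R c → ∃ λ S → S ⊆ A × c ≗ δ G S
      contained c ((S , c≗δS) , c≡0) with cut-avoiding G b₀ S
      ... | T , b₀∉T , δS≗δT = T , T⊆A , c≗δT
        where
        c≗δT : c ≗ δ G T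
        c≗δT e = trans (c≗δS e) (δS≗δT e)

        T⊆A : T ⊆ A
        T⊆A {x} x∈T = x∉∁p⇒x∈p λ x∈B → outside⇒∉ (trans
          (cuts-agreeing-on-E-R T ⊥ b₀∉T ∉⊥ (λ e e∈R → trans (sym (c≗δT e)) (trans (c≡0 e e∈R) (sym (δ-⊥ G e)))) x∈B)
          (lookup-replicate x outside)) x∈T

    -- A cut vanishing on `E-L` agrees there with `δ ⊥` and is therefore zero; the basis is empty.
    dim-vanishing-on-E-L : HasDimension (CutSpaceVanishingOn G E-L) ∣ ⊥ {n} ∣
    dim-vanishing-on-E-L = starCuts-dimension G connected ⊥ {b₀} ∉⊥
      (λ S S⊆⊥ → (S , λ _ → refl) , λ e _ →
        cong₂ _xor_ (∉⇒outside (∉⊥ ∘ S⊆⊥)) (∉⇒outside (∉⊥ ∘ S⊆⊥)))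
      contained
      where
      contained : ∀ c → CutSpaceVanishingOn G E-L c → ∃ λ S → S ⊆ ⊥ × c ≗ δ G S
      contained c ((S , c≗δS) , c≡0) = ⊥ , (λ x∈⊥ → x∈⊥) , λ e → trans (c≗δS e)
        (cut-determined-by-E-L S ⊥ (λ e e∈L → trans (sym (c≗δS e)) (trans (c≡0 e e∈L) (sym (δ-⊥ G e)))) e)

    -- Removing `b₀` from all vertices is removing it from the `B` side of the count
    -- `n = ∣ A ∣ + ∣ B ∣`.
    dim-CutSpace-≡ : ∣ ⊤ - b₀ ∣ ≡ ∣ A ∣ + ∣ B⁻ ∣
    dim-CutSpace-≡ = ℕ.suc-injective (begin
      suc ∣ ⊤ - b₀ ∣           ≡⟨ ∣p∣≡1+∣p-x∣ {x = b₀} ∈⊤ ⟨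
      ∣ ⊤ {n} ∣                ≡⟨ ∣⊤∣≡n n ⟩
      n                        ≡⟨ ℕ.m+[n∸m]≡n (∣p∣≤n A) ⟨
      ∣ A ∣ + (n ∸ ∣ A ∣)      ≡⟨ cong (∣ A ∣ +_) (trans (sym (∣∁p∣≡n∸∣p∣ A)) ∣B∣≡1+∣B⁻∣) ⟩
      ∣ A ∣ + suc ∣ B⁻ ∣       ≡⟨ ℕ.+-suc ∣ A ∣ ∣ B⁻ ∣ ⟩
      suc (∣ A ∣ + ∣ B⁻ ∣)     ∎)
      where open ≡-Reasoning

    stateComplexity : IsStateComplexity G E-L E-R ∣ B⁻ ∣
    stateComplexity = ∣ ⊤ - b₀ ∣ , ∣ A ∣ , ∣ ⊥ {n} ∣ ,
      dim-CutSpace , dim-vanishing-on-E-R , dim-vanishing-on-E-L , (begin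
        ℤ.+ ∣ B⁻ ∣
          ≡⟨ solve 2 (λ a s → s := ((a :+ s) :- a) :- con (ℤ.+ 0)) refl (ℤ.+ ∣ A ∣) (ℤ.+ ∣ B⁻ ∣) ⟩
        (ℤ.+ (∣ A ∣ + ∣ B⁻ ∣) ℤ.- ℤ.+ ∣ A ∣) ℤ.- ℤ.+ 0
          ≡⟨ cong₂ (λ d z → (ℤ.+ d ℤ.- ℤ.+ ∣ A ∣) ℤ.- ℤ.+ z) dim-CutSpace-≡ (∣⊥∣≡0 n) ⟨
        (ℤ.+ ∣ ⊤ - b₀ ∣ ℤ.- ℤ.+ ∣ A ∣) ℤ.- ℤ.+ ∣ ⊥ {n} ∣ ∎)
      where
      open ≡-Reasoning
      open ℤ.+-*-Solver

corollary2 :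
  (a : Level) (n m : ℕ) (G : Graph n m) (g : ℕ ⁺) (r : ℕ) →
  IsGirth G g → [ 2 * r + 1 ] <⁺ g →
  RadiusStatisticsConstant G a r ×
  ((A B : Subset n) → Partition A B →
   Connected G → ConnectedOn G A → ConnectedOn G B →
   (∀ b → b ∈ B → ∃ λ x → x ∈ A × Adjacent G b x) →
   let E-L = edgesInside G A ∪ edgesBetween G A B
       E-R = edgesInside G B
   in RadiusStatisticsConstant G a r ×
      IsMinPlusRank (groundStateMatrix G E-L E-R) (2 ^ (∣ B ∣ ∸ 1)) ×
      (∃ λ s → IsStateComplexity G E-L E-R s × 2 ^ (∣ B ∣ ∸ 1) ≡ 2 ^ s))
corollary2 a n m G g r girth 2r+1<g = constant , λ A B partition G-connected A-connected B-connected dominates →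
  second-part A B (partition⇒∁ partition) G-connected A-connected B-connected dominates
  where
  constant : RadiusStatisticsConstant G a r
  constant = radiusStatisticsConstant G a r girth 2r+1<g

  second-part : ∀ A B → B ≡ ∁ A → Connected G → ConnectedOn G A → ConnectedOn G B →
                (∀ b → b ∈ B → ∃ λ x → x ∈ A × Adjacent G b x) →
                let E-L = edgesInside G A ∪ edgesBetween G A B
                    E-R = edgesInside G B
                in RadiusStatisticsConstant G a r ×
                   IsMinPlusRank (groundStateMatrix G E-L E-R) (2 ^ (∣ B ∣ ∸ 1)) ×
                   (∃ λ s → IsStateComplexity G E-L E-R s × 2 ^ (∣ B ∣ ∸ 1) ≡ 2 ^ s)
  second-part A _ refl G-connected A-connected B-connected dominates =
    constant ,
    groundStateMatrix-rank G A G-connected A-connected B-connected dominates ,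
    -- The state complexity inferred here is the size of `B` without `b₀`.
    _ , stateComplexity G A G-connected A-connected B-connected dominates ,
    cong (λ k → 2 ^ (k ∸ 1)) (∣B∣≡1+∣B⁻∣ G A G-connected A-connected B-connected dominates)
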